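{- The graph isomorphism problem for connected graphs in $\Gamma_0$ (input: connected $G_1, G_2$; output YES iff $G_1 \simeq G_2$) is polynomial-time many-one reducible to the direct-product compositeness problem for unconnected, nonbipartite graphs in $\Gamma_0$ (input: an unconnected nonbipartite graph $G$; output YES iff $G$ is composite with respect to the direct product).
   Context: $\Gamma_0$ is the set of finite undirected graphs in which self-loops (edges $\{v,v\}$) are allowed. The direct product $G_1 \times G_2$ of graphs $G_1,G_2$ has node set $V(G_1)\times V(G_2)$, and $(x,y)$ is adjacent to $(x',y')$ iff $\{x,x'\}\in E(G_1)$ and $\{y,y'\}\in E(G_2)$. A graph is nontrivial if it has more than one node. A graph $G$ is composite with respect to the direct product if $G \simeq G_1 \times G_2$ for some nontrivial graphs $G_1, G_2$. "Unconnected" means not connected. A polynomial-time many-one reduction from decision problem $S_1$ to $S_2$ is a polynomial-time computable function $f$ such that $x$ is a YES-instance of $S_1$ iff $f(x)$ is a YES-instance of $S_2$. -}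

module Defs where

open import Data.Nat using (ℕ; zero; suc; _+_; _*_; _^_; _<_; _≤_)
open import Data.Fin using (Fin; zero; suc; remQuot; _≟_)
open import Data.Bool using (Bool; true; false; _∧_)
open import Data.List using (List; []; _∷_; _++_; map; concatMap; replicate; allFin; length)
open import Data.Maybe using (Maybe; just; nothing)
open import Data.Product using (Σ; _×_; _,_; proj₁; proj₂)
open import Data.Empty using (⊥)
open import Function.Bundles using (_↔_; Inverse)
open import Relation.Nullary using (¬_; yes; no)
open import Relation.Binary.PropositionalEquality using (_≡_; _≢_; cong₂)

-- Graphs of Γ₀: finite undirected graphs, self-loops allowed.
-- Node set Fin n; adjacency is a symmetric Boolean relation
-- (adj i i = true means a self-loop at i).

record Graph : Set where
  field
    n   : ℕ
    adj : Fin n → Fin n → Bool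
    sym : ∀ i j → adj i j ≡ adj j i
open Graph public

_≃G_ : Graph → Graph → Set
G ≃G H = Σ (Fin (n G) ↔ Fin (n H)) λ φ →
  ∀ i j → adj H (Inverse.to φ i) (Inverse.to φ j) ≡ adj G i j

π₁ : (G₁ G₂ : Graph) → Fin (n G₁ * n G₂) → Fin (n G₁)
π₁ G₁ G₂ i = proj₁ (remQuot {n G₁} (n G₂) i)

π₂ : (G₁ G₂ : Graph) → Fin (n G₁ * n G₂) → Fin (n G₂)
π₂ G₁ G₂ i = proj₂ (remQuot {n G₁} (n G₂) i)

_⊗_ : Graph → Graph → Graph
G₁ ⊗ G₂ = record
  { n   = n G₁ * n G₂
  ; adj = λ i j → adj G₁ (π₁ G₁ G₂ i) (π₁ G₁ G₂ j) ∧ adj G₂ (π₂ G₁ G₂ i) (π₂ G₁ G₂ j)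
  ; sym = λ i j → cong₂ _∧_ (sym G₁ (π₁ G₁ G₂ i) (π₁ G₁ G₂ j)) (sym G₂ (π₂ G₁ G₂ i) (π₂ G₁ G₂ j))
  }

Nontrivial : Graph → Set
Nontrivial G = 1 < n G

Composite : Graph → Set
Composite G = Σ Graph λ G₁ → Σ Graph λ G₂ →
  Nontrivial G₁ × Nontrivial G₂ × (G ≃G (G₁ ⊗ G₂))

data Walk (G : Graph) : Fin (n G) → Fin (n G) → Set where
  here : ∀ {i} → Walk G i i
  step : ∀ {i j k} → adj G i j ≡ true → Walk G j k → Walk G i k

Connected : Graph → Set
Connected G = (1 ≤ n G) × (∀ i j → Walk G i j)

-- Bipartite: a proper 2-colouring exists (a self-loop prevents this).
Bipartite : Graph → Set
Bipartite G = Σ (Fin (n G) → Bool) λ c → ∀ i j → adj G i j ≡ true → c i ≢ c j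

encGraph : Graph → List Bool
encGraph G = replicate (n G) true ++ (false ∷
  concatMap (λ i → map (λ j → adj G i j) (allFin (n G))) (allFin (n G)))

GI-Connected : List Bool → Set
GI-Connected x = Σ Graph λ G₁ → Σ Graph λ G₂ →
  (x ≡ encGraph G₁ ++ encGraph G₂) × Connected G₁ × Connected G₂ × (G₁ ≃G G₂)

Composite-UnconnNonbip : List Bool → Set
Composite-UnconnNonbip x = Σ Graph λ G →
  (x ≡ encGraph G) × ¬ Connected G × ¬ Bipartite G × Composite G

-- Computation model: single-tape deterministic Turing machines.
-- Tape symbols Fin (3 + nΓ): 0 = blank, 1 = bit false, 2 = bit true,
-- others are auxiliary work symbols.

data Move : Set where
  left right stay : Move

record TM : Set where
  field
    nQ    : ℕ
    nΓ    : ℕ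
    δ     : Fin (suc nQ) → Fin (3 + nΓ) → Fin (suc nQ) × Fin (3 + nΓ) × Move
    start : Fin (suc nQ)
    halt  : Fin (suc nQ)

module _ (M : TM) where
  open TM M

  Sym : Set
  Sym = Fin (3 + nΓ)

  blank : Sym
  blank = zero

  bitSym : Bool → Sym
  bitSym false = suc zero
  bitSym true  = suc (suc zero)

  -- configuration: state, tape left of head (nearest first), head symbol,
  -- tape right of head (nearest first); unrecorded cells are blank.
  record Config : Set where
    constructor conf
    field
      state : Fin (suc nQ)
      lft   : List Sym
      hd    : Sym
      rgt   : List Sym

  doMove : Move → List Sym → Sym → List Sym → List Sym × Sym × List Sym
  doMove left  []       h rs       = [] , blank , h ∷ rs
  doMove left  (l ∷ ls) h rs       = ls , l , h ∷ rs
  doMove right ls       h []       = h ∷ ls , blank , []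
  doMove right ls       h (r ∷ rs) = h ∷ ls , r , rs
  doMove stay  ls       h rs       = ls , h , rs

  stepTM : Config → Config
  stepTM (conf q ls h rs) with q ≟ halt
  ... | yes _ = conf q ls h rs
  ... | no  _ with δ q h
  ...   | (q' , s' , m) with doMove m ls s' rs
  ...     | (ls' , h' , rs') = conf q' ls' h' rs'

  run : ℕ → Config → Config
  run zero    c = c
  run (suc t) c = run t (stepTM c)

  initConf : List Bool → Config
  initConf []       = conf start [] blank []
  initConf (b ∷ bs) = conf start [] (bitSym b) (map bitSym bs)

  symBit : Sym → Maybe Bool
  symBit zero             = nothing
  symBit (suc zero)       = just false
  symBit (suc (suc zero)) = just true
  symBit (suc (suc (suc _))) = nothing

  readBits : List Sym → List Bool
  readBits []       = []
  readBits (s ∷ ss) with symBit s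
  ... | just b  = b ∷ readBits ss
  ... | nothing = []

  output : Config → List Bool
  output (conf _ _ h rs) = readBits (h ∷ rs)

  Halted : Config → Set
  Halted c = Config.state c ≡ halt

PolyTimeComputable : (List Bool → List Bool) → Set
PolyTimeComputable f = Σ TM λ M → Σ ℕ λ c → Σ ℕ λ k → ∀ w →
  Halted M (run M (c * length w ^ k + c) (initConf M w)) ×
  (output M (run M (c * length w ^ k + c) (initConf M w)) ≡ f w)

_≤ₚ_ : (List Bool → Set) → (List Bool → Set) → Set
S₁ ≤ₚ S₂ = Σ (List Bool → List Bool) λ f →
  PolyTimeComputable f × (∀ x → (S₁ x → S₂ (f x)) × (S₂ (f x) → S₁ x))

{-# OPTIONS --safe #-}

-- Given matrices of G₁ and G₂, the reduction checks that both are symmetric and connected and then outputs the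
-- disjoint union H₁ + H₂, where Hᵢ is Gᵢ with two more nodes: uᵢ, adjacent to every node of Gᵢ, and pᵢ,
-- adjacent to every node including uᵢ and itself. If the checks fail, the output encodes no graph.
--
-- If G₁ ≃ G₂, then H₁ + H₂ is the product of H₁ with two isolated loops. Conversely let H₁ + H₂ ≃ A × B, with
-- pᵢ = (aᵢ, bᵢ). The node (a₁, b₂) is adjacent to p₁ or to p₂, so b₁ ∼ b₂ or a₁ ∼ a₂; say b₁ ∼ b₂. Every node is
-- adjacent to exactly one of p₁ and p₂, hence no x is adjacent to both a₁ and a₂, and Hᵢ = N(aᵢ) × B. As uᵢ is
-- adjacent to all nodes of Hᵢ but itself and B is nontrivial, N(aᵢ) is a single node with a loop. So
-- H₁ ≃ B ≃ H₂, and the two extra nodes can be cancelled because any two nodes of the same kind are twins.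
--
-- Connectivity is decided by vertex elimination: deleting a node with a neighbour and turning its neighbourhood
-- into a clique changes nothing about the connectivity of the remaining nodes.
--
-- Polynomial time is obtained from a language of programs over queues of bits whose only loops make as many
-- iterations as the input has bits. A queue is a track of the tape, and every operation on it is a sweep over
-- the tape and back.

module Submission where

-- Why two extra nodes: `p` alone would leave the factors undetermined. From `b₁ ∼ b₂` one would
-- only learn that the summands are `N(a₁) × B` and `N(a₂) × B`, where the neighbourhoods may
-- differ. A node adjacent to everything but itself excludes a proper factorization of a summand.
-- The loop at `p` also makes the sum nonbipartite, and the added nodes make each summand nontrivial
-- even if the given graph has a single node.
--
-- Problems are sets of words, so malformed words and unconnected graphs are NO-instances and have
-- to be recognized: two isomorphic unconnected graphs would otherwise yield a composite sum.
-- Elimination suits the machine model because it deletes the first row and column while the matrix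
-- passes once through a queue, without random access.
--
-- A loop of the program language cannot be left early. Its body is therefore written so that
-- surplus iterations find an empty queue or a raised flag and change nothing. In return the time
-- bound follows from the syntax alone and stays separate from functional correctness.

open import Defs hiding (blank)
open import Data.Bool using (Bool; true; false; _∧_; _∨_; if_then_else_; not; _xor_)
open import Data.Bool.Properties using (∧-comm; ∧-conicalˡ; ∧-conicalʳ; ∨-identityʳ; ∨-zeroʳ; xor-same)
open import Data.Empty using (⊥; ⊥-elim)
open import Data.Fin using (Fin; zero; suc; splitAt; join; combine; remQuot; _↑ˡ_; _↑ʳ_; toℕ; fromℕ<; _≟_; #_)
open import Data.Fin.Permutation using (↔⇒≡)
open import Data.Fin.Properties using (splitAt-join; remQuot-combine; toℕ-fromℕ<; ↑ˡ-injective; ↑ʳ-injective; splitAt-↑ˡ; splitAt-↑ʳ; join-splitAt; combine-remQuot; suc-injective)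
open import Data.List as List using (List; []; _∷_; _++_; map; replicate; length; _ʳ++_; concat; tabulate; take; drop; allFin)
open import Data.List.Properties using (map-++; length-++; length-map; ++-identityʳ; ++-assoc; length-replicate; length-tabulate; length-take; length-drop; take++drop≡id; tabulate-lookup; map-tabulate; tabulate-cong; ∷-injective)
open import Data.List.Relation.Unary.All using (All; []; _∷_)
import Data.List.Relation.Unary.All.Properties as All
open import Data.Maybe as Maybe using (Maybe; just; nothing; _>>=_; maybe′)
open import Data.Nat using (ℕ; zero; suc; _+_; _*_; _^_; _<_; _≤_; z≤n; s≤s; _≡ᵇ_; _⊓_; _∸_; pred)
open import Data.Nat.Properties hiding (_≟_; suc-injective)
open import Data.Nat.Tactic.RingSolver using (solve-∀)
import Data.Product as Prod
open import Data.Product using (_×_; _,_; proj₁; proj₂; ∃)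
open import Data.Sum using (_⊎_; inj₁; inj₂; [_,_]′; swap)
open import Data.Sum.Properties using (inj₁-injective; swap-involutive)
open import Data.Unit using (⊤; tt)
open import Data.Vec as Vec using (Vec; []; _∷_; lookup; _[_]≔_)
open import Data.Vec.Properties using (lookup∘update; lookup∘update′; lookup-replicate; []≔-lookup; []≔-idempotent; lookup-++ˡ; lookup-++ʳ)
open import Function using (_∘_; id)
open import Function.Bundles using (Inverse; mk↔ₛ′)
open import Relation.Binary.PropositionalEquality as Eq using (_≡_; refl; trans; cong; cong₂; subst; _≢_)
open import Relation.Nullary using (yes; no; ¬_; does)

-- Turing machines

-- `A` is a retract of `Fin size`. Codes outside the image of `enc` become states or symbols that no
-- simulated run reaches.
record Finite (A : Set) : Set where
  no-eta-equality
  field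
    size    : ℕ
    enc     : A → Fin size
    dec     : Fin size → A
    dec-enc : ∀ a → dec (enc a) ≡ a
open Finite

⊤-finite : Finite ⊤
⊤-finite = record { size = 1 ; enc = λ _ → zero ; dec = λ _ → tt ; dec-enc = λ _ → refl }

Bool-finite : Finite Bool
Bool-finite = record
  { size = 2
  ; enc = λ { false → zero ; true → suc zero }
  ; dec = λ { zero → false ; (suc _) → true }
  ; dec-enc = λ { false → refl ; true → refl } }

Maybe-finite : ∀ {A} → Finite A → Finite (Maybe A)
Maybe-finite F = record
  { size = suc (size F)
  ; enc = λ { nothing → zero ; (just a) → suc (enc F a) }
  ; dec = λ { zero → nothing ; (suc i) → just (dec F i) }
  ; dec-enc = λ { nothing → refl ; (just a) → cong just (dec-enc F a) } }

⊎-finite : ∀ {A B} → Finite A → Finite B → Finite (A ⊎ B)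
⊎-finite {A} {B} F G = record
  { size = size F + size G
  ; enc = λ x → join (size F) (size G) (to x)
  ; dec = λ i → from (splitAt (size F) i)
  ; dec-enc = λ x → trans (cong from (splitAt-join (size F) (size G) (to x))) (from-to x) }
  where
  to : A ⊎ B → Fin (size F) ⊎ Fin (size G)
  to (inj₁ a) = inj₁ (enc F a)
  to (inj₂ b) = inj₂ (enc G b)
  from : Fin (size F) ⊎ Fin (size G) → A ⊎ B
  from (inj₁ i) = inj₁ (dec F i)
  from (inj₂ j) = inj₂ (dec G j)
  from-to : ∀ x → from (to x) ≡ x
  from-to (inj₁ a) = cong inj₁ (dec-enc F a)
  from-to (inj₂ b) = cong inj₂ (dec-enc G b)

Vec-finite : ∀ {A} → Finite A → ∀ n → Finite (Vec A n)
Vec-finite F zero = record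
  { size = 1 ; enc = λ _ → zero ; dec = λ _ → [] ; dec-enc = λ { [] → refl } }
Vec-finite F (suc n) = record
  { size = size F * size G
  ; enc = λ { (a ∷ v) → combine (enc F a) (enc G v) }
  ; dec = λ i → dec F (proj₁ (remQuot (size G) i)) ∷ dec G (proj₂ (remQuot {size F} (size G) i))
  ; dec-enc = λ { (a ∷ v) → trans
      (cong (λ p → dec F (proj₁ p) ∷ dec G (proj₂ p)) (remQuot-combine (enc F a) (enc G v)))
      (cong₂ _∷_ (dec-enc F a) (dec-enc G v)) } }
  where G = Vec-finite F n

data Symbol (C : Set) : Set where
  blank : Symbol C
  bit   : Bool → Symbol C
  cell  : C → Symbol C

-- A machine leaves its state space through an exit. Exit nothing means normal termination, or that
-- an inspected queue was empty; just b carries a bit read, and just _ also signals rejection.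
Exit : Set
Exit = Maybe Bool

module Machines (C : Set) (C-finite : Finite C) where

  Γ : Set
  Γ = Symbol C

  Tape : Set
  Tape = List Γ × Γ × List Γ

  enter : List Γ → List Γ → Tape
  enter ls []       = ls , blank , []
  enter ls (g ∷ gs) = ls , g , gs

  enterˡ : List Γ → List Γ → Tape
  enterˡ []       rs = [] , blank , rs
  enterˡ (l ∷ ls) rs = ls , l , rs

  move : Move → List Γ → Γ → List Γ → Tape
  move left  ls g rs = enterˡ ls (g ∷ rs)
  move right ls g rs = enter (g ∷ ls) rs
  move stay  ls g rs = ls , g , rs

  record Machine : Set₁ where
    no-eta-equality
    field
      Q        : Set
      Q-finite : Finite Q
      start    : Q
      δ        : Q → Γ → (Q ⊎ Exit) × Γ × Move
  open Machine public

  -- The exiting transition counts as a step. Inside a larger machine this transition is redirected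
  -- to another state, so that times add up exactly.
  data Run (M : Machine) : Q M → Tape → ℕ → Exit → Tape → Set where
    stop : ∀ {q ls g rs x s m} → δ M q g ≡ (inj₂ x , s , m) →
           Run M q (ls , g , rs) 1 x (move m ls s rs)
    step : ∀ {q ls g rs q′ s m t x T} → δ M q g ≡ (inj₁ q′ , s , m) →
           Run M q′ (move m ls s rs) t x T → Run M q (ls , g , rs) (suc t) x T

  -- Both `bind` and `while` are instances: `κ` sends an exit of a part either to the start of the
  -- next part or to an exit of the whole.
  module Embedding (M N : Machine) (e : Q M → Q N) (κ : Exit → Q N ⊎ Exit)
    (δ-e : ∀ q g → δ N (e q) g ≡ Prod.map₁ [ inj₁ ∘ e , κ ]′ (δ M q g)) where

    private
      δ-exit : ∀ {q g x s m} → δ M q g ≡ (inj₂ x , s , m) → δ N (e q) g ≡ (κ x , s , m)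
      δ-exit {q} {g} eq = trans (δ-e q g) (cong (Prod.map₁ [ inj₁ ∘ e , κ ]′) eq)

      δ-step : ∀ {q g q′ s m} → δ M q g ≡ (inj₁ q′ , s , m) → δ N (e q) g ≡ (inj₁ (e q′) , s , m)
      δ-step {q} {g} eq = trans (δ-e q g) (cong (Prod.map₁ [ inj₁ ∘ e , κ ]′) eq)

    exit : ∀ {q T t x T′ y} → κ x ≡ inj₂ y → Run M q T t x T′ → Run N (e q) T t y T′
    exit κx (stop {s = s} {m} eq) = stop (trans (δ-exit eq) (cong (_, s , m) κx))
    exit κx (step eq r) = step (δ-step eq) (exit κx r)

    continue : ∀ {q T t x T′ q′ t′ y T″} → κ x ≡ inj₁ q′ → Run M q T t x T′ →
               Run N q′ T′ t′ y T″ → Run N (e q) T (t + t′) y T″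
    continue κx (stop {s = s} {m} eq) r′ = step (trans (δ-exit eq) (cong (_, s , m) κx)) r′
    continue κx (step eq r) r′ = step (δ-step eq) (continue κx r r′)

  module _ (M : Machine) (N : Exit → Machine) where
    private
      BindQ : Set
      BindQ = Q M ⊎ (Q (N nothing) ⊎ (Q (N (just false)) ⊎ Q (N (just true))))

      inject : ∀ x → Q (N x) → BindQ
      inject nothing      = inj₂ ∘ inj₁
      inject (just false) = inj₂ ∘ inj₂ ∘ inj₁
      inject (just true)  = inj₂ ∘ inj₂ ∘ inj₂

      next : Exit → BindQ ⊎ Exit
      next x = inj₁ (inject x (start (N x)))

      sub : ∀ x → (Q (N x) ⊎ Exit) × Γ × Move → (BindQ ⊎ Exit) × Γ × Move
      sub x = Prod.map₁ [ inj₁ ∘ inject x , inj₂ ]′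

      bind-δ : BindQ → Γ → (BindQ ⊎ Exit) × Γ × Move
      bind-δ (inj₁ q)               g = Prod.map₁ [ inj₁ ∘ inj₁ , next ]′ (δ M q g)
      bind-δ (inj₂ (inj₁ q))        g = sub nothing (δ (N nothing) q g)
      bind-δ (inj₂ (inj₂ (inj₁ q))) g = sub (just false) (δ (N (just false)) q g)
      bind-δ (inj₂ (inj₂ (inj₂ q))) g = sub (just true) (δ (N (just true)) q g)

    -- Comparing unfolded machines is infeasible for the type checker.
    abstract
      bind : Machine
      bind = record
        { Q = BindQ
        ; Q-finite = ⊎-finite (Q-finite M) (⊎-finite (Q-finite (N nothing))
                       (⊎-finite (Q-finite (N (just false))) (Q-finite (N (just true)))))
        ; start = inj₁ (start M)
        ; δ = bind-δ }

      bind-run : ∀ {T t x T′ t′ y T″} → Run M (start M) T t x T′ →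
                 Run (N x) (start (N x)) T′ t′ y T″ → Run bind (start bind) T (t + t′) y T″
      bind-run {x = x} r r′ = Embedding.continue M bind inj₁ next (λ _ _ → refl) refl r
        (Embedding.exit (N x) bind (inject x) inj₂ (δ-inject x) refl r′)
        where
        δ-inject : ∀ x q g → bind-δ (inject x q) g ≡ sub x (δ (N x) q g)
        δ-inject nothing      q g = refl
        δ-inject (just false) q g = refl
        δ-inject (just true)  q g = refl

  module _ (M N : Machine) where
    private
      WhileQ : Set
      WhileQ = Q M ⊎ Q N

      -- The two machines use their exits differently. For the guard, `nothing` means that the
      -- counter is used up; for the body, `just` is a rejection, which must leave the loop.
      enter-body again : Exit → WhileQ ⊎ Exit
      enter-body nothing  = inj₂ nothing
      enter-body (just _) = inj₁ (inj₂ (start N))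
      again nothing  = inj₁ (inj₁ (start M))
      again (just b) = inj₂ (just b)

    abstract
      while : Machine
      while = record
        { Q = WhileQ
        ; Q-finite = ⊎-finite (Q-finite M) (Q-finite N)
        ; start = inj₁ (start M)
        ; δ = λ { (inj₁ q) g → Prod.map₁ [ inj₁ ∘ inj₁ , enter-body ]′ (δ M q g)
                ; (inj₂ q) g → Prod.map₁ [ inj₁ ∘ inj₂ , again ]′ (δ N q g) } }

      while-end : ∀ {T t T′} → Run M (start M) T t nothing T′ →
                  Run while (start while) T t nothing T′
      while-end = Embedding.exit M while inj₁ enter-body (λ _ _ → refl) refl

      while-break : ∀ {T t b T′ t′ d T″} → Run M (start M) T t (just b) T′ →
                    Run N (start N) T′ t′ (just d) T″ →
                    Run while (start while) T (t + t′) (just d) T″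
      while-break r r′ = Embedding.continue M while inj₁ enter-body (λ _ _ → refl) refl r
          (Embedding.exit N while inj₂ again (λ _ _ → refl) refl r′)

      while-again : ∀ {T t b T′ t′ T″ t″ x T‴} → Run M (start M) T t (just b) T′ →
                    Run N (start N) T′ t′ nothing T″ → Run while (start while) T″ t″ x T‴ →
                    Run while (start while) T (t + (t′ + t″)) x T‴
      while-again r r′ r″ = Embedding.continue M while inj₁ enter-body (λ _ _ → refl) refl r
          (Embedding.continue N while inj₂ again (λ _ _ → refl) refl r′ r″)

  return : Exit → Machine
  return x = record
    { Q = ⊤ ; Q-finite = ⊤-finite ; start = tt ; δ = λ _ g → inj₂ x , g , stay }

  return-run : ∀ x T → Run (return x) tt T 1 x T
  return-run x T = stop refl

  readΓ : List Γ → List Bool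
  readΓ (bit b ∷ gs) = b ∷ readΓ gs
  readΓ _            = []

  scanned : Tape → List Bool
  scanned (_ , g , gs) = readΓ (g ∷ gs)

  module ToTM (M : Machine) where
    private
      encS : Γ → Fin (3 + size C-finite)
      encS blank       = zero
      encS (bit false) = suc zero
      encS (bit true)  = suc (suc zero)
      encS (cell c)    = suc (suc (suc (enc C-finite c)))

      decS : Fin (3 + size C-finite) → Γ
      decS zero                = blank
      decS (suc zero)          = bit false
      decS (suc (suc zero))    = bit true
      decS (suc (suc (suc i))) = cell (dec C-finite i)

      decS-encS : ∀ g → decS (encS g) ≡ g
      decS-encS blank       = refl
      decS-encS (bit false) = refl
      decS-encS (bit true)  = refl
      decS-encS (cell c)    = cong cell (dec-enc C-finite c)

      encQ : Q M ⊎ Exit → Fin (suc (size (Q-finite M)))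
      encQ (inj₁ q) = suc (enc (Q-finite M) q)
      encQ (inj₂ _) = zero

      encR : (Q M ⊎ Exit) × Γ × Move → Fin (suc (size (Q-finite M))) × Fin (3 + size C-finite) × Move
      encR (q , g , m) = encQ q , encS g , m

      δ′ : Fin (suc (size (Q-finite M))) → Fin (3 + size C-finite) →
           Fin (suc (size (Q-finite M))) × Fin (3 + size C-finite) × Move
      δ′ zero    s = zero , s , stay
      δ′ (suc q) s = encR (δ M (dec (Q-finite M) q) (decS s))

    tm : TM
    tm = record
      { nQ = size (Q-finite M) ; nΓ = size C-finite ; δ = δ′
      ; start = encQ (inj₁ (start M)) ; halt = zero }

    private
      encT : Q M ⊎ Exit → Tape → Config tm
      encT q (ls , g , rs) = conf (encQ q) (map encS ls) (encS g) (map encS rs)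

      step-enc : ∀ q ls g rs {r s m} → δ M q g ≡ (r , s , m) →
                 stepTM tm (encT (inj₁ q) (ls , g , rs)) ≡ encT r (move m ls s rs)
      step-enc q ls g rs {s = s} {m} eq
        rewrite dec-enc (Q-finite M) q | decS-encS g | eq = go m ls s rs
        where
        go : ∀ m ls s rs {r} → let (ls′ , h′ , rs′) = doMove tm m (map encS ls) (encS s) (map encS rs) in
             _≡_ {A = Config tm} (conf (encQ r) ls′ h′ rs′) (encT r (move m ls s rs))
        go left  []       s rs = refl
        go left  (l ∷ ls) s rs = refl
        go right ls       s [] = refl
        go right ls       s (r ∷ rs) = refl
        go stay  ls       s rs = refl

      run-halted : ∀ t c → Config.state c ≡ zero → run tm t c ≡ c
      run-halted zero    c eq = refl
      run-halted (suc t) (conf .zero ls h rs) refl = run-halted t _ refl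

      -- `PolyTimeComputable` inspects the configuration after the full time bound. Hence the slack
      -- `u`, during which the halted configuration stays fixed.
      run-enc : ∀ {q T t x T′} → Run M q T t x T′ → ∀ u →
                run tm (t + u) (encT (inj₁ q) T) ≡ encT (inj₂ x) T′
      run-enc (stop {q} {ls} {g} {rs} eq) u =
        trans (cong (run tm u) (step-enc q ls g rs eq)) (run-halted u _ refl)
      run-enc (step {q} {ls} {g} {rs} {t = t} eq r) u =
        trans (cong (run tm (t + u)) (step-enc q ls g rs eq)) (run-enc r u)

    private
      readBits-enc : ∀ gs → readBits tm (map encS gs) ≡ readΓ gs
      readBits-enc []               = refl
      readBits-enc (blank ∷ gs)     = refl
      readBits-enc (bit false ∷ gs) = cong (false ∷_) (readBits-enc gs)
      readBits-enc (bit true ∷ gs)  = cong (true ∷_) (readBits-enc gs)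
      readBits-enc (cell c ∷ gs)    = refl

      init-enc : ∀ w → initConf tm w ≡ encT (inj₁ (start M)) (enter [] (map bit w))
      init-enc [] = refl
      init-enc (b ∷ w) = cong₂ (λ h rs → conf _ [] h rs) (bit-enc b) (bits-enc w)
        where
        bit-enc : ∀ b → bitSym tm b ≡ encS (bit b)
        bit-enc false = refl
        bit-enc true  = refl
        bits-enc : ∀ w → map (bitSym tm) w ≡ map encS (map bit w)
        bits-enc []      = refl
        bits-enc (b ∷ w) = cong₂ _∷_ (bit-enc b) (bits-enc w)

    correct : ∀ w {t x T} → Run M (start M) (enter [] (map bit w)) t x T → ∀ {u} → t ≤ u →
              Halted tm (run tm u (initConf tm w)) × output tm (run tm u (initConf tm w)) ≡ scanned T
    correct w {T = T} r {u} t≤u with m≤n⇒∃[o]m+o≡n t≤u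
    ... | o , refl rewrite init-enc w | run-enc r o = refl , readBits-enc (proj₁ (proj₂ T) ∷ proj₂ (proj₂ T))

-- Sweeps over multi-track tapes

-- The value of a track in a cell; nothing marks a position beyond the end of the track's contents.
Value : Set
Value = Maybe Bool

-- A left-to-right pass over the values of one track followed by a right-to-left pass.
record Sweep : Set where
  field
    init    : Value
    forth   : Value → Value → Value × Value
    append  : Value → Maybe Bool
    turn    : Value → Value
    back    : Value → Value → Value × Value

mapAccumˡ mapAccumʳ : ∀ {A S : Set} → (S → A → S × A) → S → List A → S × List A
mapAccumˡ f s []       = s , []
mapAccumˡ f s (a ∷ as) =
  let (s′ , a′) = f s a ; (s″ , as′) = mapAccumˡ f s′ as in s″ , a′ ∷ as′
mapAccumʳ f s []       = s , []
mapAccumʳ f s (a ∷ as) =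
  let (s′ , as′) = mapAccumʳ f s as ; (s″ , a′) = f s′ a in s″ , a′ ∷ as′

appended : Maybe Bool → List Value
appended nothing  = []
appended (just b) = just b ∷ []

module _ (o : Sweep) where
  open Sweep o

  sweep : List Value → Value × List Value
  sweep vs =
    let (s , vs′) = mapAccumˡ forth init vs ; (s′ , vs″) = mapAccumʳ back (turn s) vs′
    in s′ , vs″ ++ appended (append s)

data Contents : List Value → List Bool → Set where
  []  : ∀ {vs} → All (_≡ nothing) vs → Contents vs []
  _∷_ : ∀ b {vs bs} → Contents vs bs → Contents (just b ∷ vs) (b ∷ bs)

-- The quantifier ranges over all paddings, because the tape may have been lengthened by other
-- tracks.
Sweeps : Sweep → List Bool → Value → List Bool → Set
Sweeps o bs v bs′ = ∀ {vs} → Contents vs bs → proj₁ (sweep o vs) ≡ v × Contents (proj₂ (sweep o vs)) bs′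

contents-++ : ∀ {vs bs us} → Contents vs bs → All (_≡ nothing) us → Contents (vs ++ us) bs
contents-++ ([] ns)  us = [] (All.++⁺ ns us)
contents-++ (b ∷ cs) us = b ∷ contents-++ cs us

module Tracks (K : ℕ) (input : Bool → Vec Value K) where

  Cell : Set
  Cell = Vec Value K

  open Machines Cell (Vec-finite (Maybe-finite Bool-finite) K) public

  -- A raw input bit counts as a cell that already carries the initial values of all tracks, so no
  -- conversion pass precedes the first sweep.
  toCell : Γ → Maybe Cell
  toCell blank    = nothing
  toCell (bit b)  = just (input b)
  toCell (cell c) = just c

  data _Reads_ : List Γ → List Cell → Set where
    []  : ∀ {gs} → All (_≡ blank) gs → gs Reads []
    _∷_ : ∀ {g gs c w} → toCell g ≡ just c → gs Reads w → (g ∷ gs) Reads (c ∷ w)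

  -- The home position, in which the compiled machines start and end. Its blank is the left end
  -- marker of every return pass.
  rest : List Γ → Tape
  rest gs = [] , blank , gs

  column : Fin K → List Cell → List Value
  column i = map (λ c → lookup c i)

  reads-cells : ∀ w {gs w′} → gs Reads w′ → (map cell w ++ gs) Reads (w ++ w′)
  reads-cells []      r = r
  reads-cells (c ∷ w) r = refl ∷ reads-cells w r

  module _ (i : Fin K) where

    onCell : (Value → Value → Value × Value) → Value → Cell → Value × Cell
    onCell f s c = let (s′ , v) = f s (lookup c i) in s′ , (c [ i ]≔ v)

    newCells : Maybe Bool → List Cell
    newCells nothing  = []
    newCells (just b) = (Vec.replicate K nothing [ i ]≔ just b) ∷ []

    column-mapAccumˡ : ∀ f s w → let (s′ , w′) = mapAccumˡ (onCell f) s w in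
                       (s′ , column i w′) ≡ mapAccumˡ f s (column i w)
    column-mapAccumˡ f s []      = refl
    column-mapAccumˡ f s (c ∷ w) = cong₂ (λ v (s , vs) → s , v ∷ vs) (lookup∘update i c _) (column-mapAccumˡ f _ w)

    column-mapAccumʳ : ∀ f s w → let (s′ , w′) = mapAccumʳ (onCell f) s w in
                       (s′ , column i w′) ≡ mapAccumʳ f s (column i w)
    column-mapAccumʳ f s []      = refl
    column-mapAccumʳ f s (c ∷ w) = trans
      (cong (λ v → proj₁ (onCell f (proj₁ (mapAccumʳ (onCell f) s w)) c) , v ∷ column i (proj₂ (mapAccumʳ
          (onCell f) s w)))
        (lookup∘update i c _))
      (cong (λ (s , vs) → let (s′ , v) = f s (lookup c i) in s′ , v ∷ vs) (column-mapAccumʳ f s w))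

    column-newCells : ∀ m → column i (newCells m) ≡ appended m
    column-newCells nothing  = refl
    column-newCells (just b) = cong (_∷ []) (lookup∘update i (Vec.replicate K nothing) (just b))

    module _ {j : Fin K} (j≢i : j ≢ i) where

      column-mapAccumˡ′ : ∀ f s w → column j (proj₂ (mapAccumˡ (onCell f) s w)) ≡ column j w
      column-mapAccumˡ′ f s []      = refl
      column-mapAccumˡ′ f s (c ∷ w) = cong₂ _∷_ (lookup∘update′ j≢i c _) (column-mapAccumˡ′ f _ w)

      column-mapAccumʳ′ : ∀ f s w → column j (proj₂ (mapAccumʳ (onCell f) s w)) ≡ column j w
      column-mapAccumʳ′ f s []      = refl
      column-mapAccumʳ′ f s (c ∷ w) = cong₂ _∷_ (lookup∘update′ j≢i c _) (column-mapAccumʳ′ f _ w)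

      column-newCells′ : ∀ m → All (_≡ nothing) (column j (newCells m))
      column-newCells′ nothing  = []
      column-newCells′ (just b) =
        trans (lookup∘update′ j≢i (Vec.replicate K nothing) (just b)) (lookup-replicate j nothing) ∷ []

    length-mapAccumˡ : ∀ f s (w : List Cell) → length (proj₂ (mapAccumˡ (onCell f) s w)) ≡ length w
    length-mapAccumˡ f s []      = refl
    length-mapAccumˡ f s (c ∷ w) = cong suc (length-mapAccumˡ f _ w)

    length-mapAccumʳ : ∀ f s (w : List Cell) → length (proj₂ (mapAccumʳ (onCell f) s w)) ≡ length w
    length-mapAccumʳ f s []      = refl
    length-mapAccumʳ f s (c ∷ w) = cong suc (length-mapAccumʳ f _ w)

    length-newCells : ∀ m → length (newCells m) ≤ 1
    length-newCells nothing  = z≤n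
    length-newCells (just b) = s≤s z≤n

    module _ (o : Sweep) where
      open Sweep o

      private
        -- `nothing` is the departure from the home position, `inj₁` the forward pass and `inj₂` the
        -- return pass, each with the value carried along.
        SweepQ : Set
        SweepQ = Maybe (Value ⊎ Value)

        newSymbol : Maybe Bool → Γ
        newSymbol nothing  = blank
        newSymbol (just b) = cell (Vec.replicate K nothing [ i ]≔ just b)

        forth-δ back-δ : Value → Maybe Cell → (SweepQ ⊎ Exit) × Γ × Move
        forth-δ s nothing  = inj₁ (just (inj₂ (turn s))) , newSymbol (append s) , left
        forth-δ s (just c) = let (s′ , c′) = onCell forth s c in inj₁ (just (inj₁ s′)) , cell c′ , right
        back-δ s nothing  = inj₂ s , blank , stay
        back-δ s (just c) = let (s′ , c′) = onCell back s c in inj₁ (just (inj₂ s′)) , cell c′ , left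

        sweep-δ : SweepQ → Γ → (SweepQ ⊎ Exit) × Γ × Move
        sweep-δ nothing         g = inj₁ (just (inj₁ init)) , g , right
        sweep-δ (just (inj₁ s)) g = forth-δ s (toCell g)
        sweep-δ (just (inj₂ s)) g = back-δ s (toCell g)

      sweeper : Machine
      sweeper = record
        { Q = SweepQ ; start = nothing ; δ = sweep-δ
        ; Q-finite = Maybe-finite (⊎-finite (Maybe-finite Bool-finite) (Maybe-finite Bool-finite)) }

      private
        -- In continuation form: a run from the turning point is extended to one from the beginning
        -- of the pass. The existential `gs′` is the blank tape beyond the turning point, which may
        -- or may not be recorded explicitly.
        run-forth : ∀ {s gs w ls} → gs Reads w → let (s′ , w′) = mapAccumˡ (onCell forth) s w in
          ∃ λ gs′ → All (_≡ blank) gs′ × (∀ {t x T} →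
            Run sweeper (just (inj₂ (turn s′))) (enterˡ (map cell w′ ʳ++ ls) (newSymbol (append s′) ∷ gs′)) t x T →
            Run sweeper (just (inj₁ s)) (enter ls gs) (length w + suc t) x T)
        run-forth {gs = []}     ([] [])          = [] , [] , step refl
        run-forth {gs = g ∷ gs} ([] (refl ∷ bs)) = gs , bs , step refl
        run-forth {s} {ls = ls} (eq ∷ r)         =
          let (gs′ , bs , k) = run-forth r in gs′ , bs , λ r′ → step (cong (forth-δ s) eq) (k r′)

        run-back : ∀ {s} w {ls gs t x T} → let (s′ , w′) = mapAccumʳ (onCell back) s w in
          Run sweeper (just (inj₂ s′)) (enterˡ ls (map cell w′ ++ gs)) t x T →
          Run sweeper (just (inj₂ s)) (enterˡ (map cell w ʳ++ ls) gs) (length w + t) x T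
        run-back []      k = k
        run-back {s} (c ∷ w) {ls} {gs} {t} {x} {T} k =
          subst (λ n → Run sweeper (just (inj₂ s)) (enterˡ (map cell w ʳ++ (cell c ∷ ls)) gs) n x T)
            (+-suc (length w) t) (run-back w {cell c ∷ ls} {gs} (step refl k))

        reads-new : ∀ m {gs} → All (_≡ blank) gs → (newSymbol m ∷ gs) Reads newCells m
        reads-new nothing  bs = [] (refl ∷ bs)
        reads-new (just b) bs = refl ∷ [] bs

      record Swept (gs : List Γ) (w : List Cell) (v : Value) (bs′ : List Bool) : Set where
        field
          {gs′}    : List Γ
          {w′}     : List Cell
          {time}   : ℕ
          running  : Run sweeper nothing (rest gs) time v (rest gs′)
          reads    : gs′ Reads w′
          swept    : Contents (column i w′) bs′
          kept     : ∀ {j} → j ≢ i → ∀ {cs} → Contents (column j w) cs → Contents (column j w′) cs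
          length-≤ : length w′ ≤ suc (length w)
          -- Besides the two passes there are three steps: leaving home, turning, and exiting at
          -- home.
          time-≤   : time ≤ 3 + (length w + length w)

      sweeper-correct : ∀ {bs v bs′ gs w} → Sweeps o bs v bs′ → gs Reads w → Contents (column i w) bs →
                        Swept gs w v bs′
      sweeper-correct {bs} {v} {bs′} {gs} {w} sw r c = record
        { running = step refl (run-to-end (run-back w₁ (stop back-end)))
        ; reads = reads-cells w₂ (reads-new (append s₁) blanks)
        ; swept = subst (λ p → Contents (proj₂ p) bs′) (Eq.sym sweep-w) (proj₂ (sw c))
        ; kept = λ {j} j≢i cs → subst (λ vs → Contents vs _) (Eq.sym (column-w₃ j≢i))
                   (contents-++ cs (column-newCells′ j≢i (append s₁)))
        ; length-≤ = begin
            length w₃                                    ≡⟨ length-++ w₂ ⟩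
            length w₂ + length (newCells (append s₁))    ≤⟨ +-monoʳ-≤ (length w₂) (length-newCells (append s₁)) ⟩
            length w₂ + 1                                ≡⟨ +-comm (length w₂) 1 ⟩
            suc (length w₂)                              ≡⟨ cong suc (length-mapAccumʳ back (turn s₁) w₁) ⟩
            suc (length w₁)                              ≡⟨ cong suc w₁-length ⟩
            suc (length w)                               ∎
        ; time-≤ = begin
            suc (length w + suc (length w₁ + 1))         ≡⟨ cong (λ n → suc (length w + suc (n + 1))) w₁-length ⟩
            suc (length w + suc (length w + 1))          ≡⟨ cong suc (+-suc (length w) (length w + 1)) ⟩
            2 + (length w + (length w + 1))              ≡⟨ cong (2 +_) (+-assoc (length w) (length w) 1) ⟨
            2 + (length w + length w + 1)                ≡⟨ cong (2 +_) (+-comm (length w + length w) 1) ⟩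
            3 + (length w + length w)                    ∎ }
        where
        open ≤-Reasoning hiding (stop)
        s₁ = proj₁ (mapAccumˡ (onCell forth) init w)
        w₁ = proj₂ (mapAccumˡ (onCell forth) init w)
        s₂ = proj₁ (mapAccumʳ (onCell back) (turn s₁) w₁)
        w₂ = proj₂ (mapAccumʳ (onCell back) (turn s₁) w₁)
        w₃ = w₂ ++ newCells (append s₁)
        w₁-length : length w₁ ≡ length w
        w₁-length = length-mapAccumˡ forth init w
        blanks = proj₁ (proj₂ (run-forth {init} {ls = blank ∷ []} r))
        run-to-end : ∀ {t x T} → Run sweeper (just (inj₂ (turn s₁))) (enterˡ (map cell w₁ ʳ++
            (blank ∷ [])) _) t x T → Run sweeper _ _ _ x T
        run-to-end {t} {x} {T} = proj₂ (proj₂ (run-forth {init} {ls = blank ∷ []} r)) {t} {x} {T}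
        sweep-w : (s₂ , column i w₃) ≡ sweep o (column i w)
        sweep-w = trans (cong (s₂ ,_) (trans (map-++ _ w₂ _) (cong (column i w₂ ++_) (column-newCells (append s₁)))))
          (trans (cong (λ (s , vs) → s , vs ++ appended (append s₁)) (column-mapAccumʳ back (turn s₁) w₁))
          (cong (λ (s , vs) → let (s′ , vs′) = mapAccumʳ back (turn s) vs in s′ , vs′ ++ appended (append s))
            (column-mapAccumˡ forth init w)))
        column-w₃ : ∀ {j} → j ≢ i → column j w₃ ≡ column j w ++ column j (newCells (append s₁))
        column-w₃ {j} j≢i = trans (map-++ _ w₂ _) (cong (_++ column j (newCells (append s₁)))
          (trans (column-mapAccumʳ′ j≢i back (turn s₁) w₁) (column-mapAccumˡ′ j≢i forth init w)))
        back-end : (inj₂ s₂ , blank , stay) ≡ (inj₂ v , blank , stay)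
        back-end = cong (λ s → inj₂ s , blank , stay) (trans (cong proj₁ sweep-w) (proj₁ (sw c)))

-- Sweeps that implement queues and counters

mapAccumˡ-id : ∀ {A S : Set} {f : S → A → S × A} {s} → (∀ a → f s a ≡ (s , a)) → ∀ as → mapAccumˡ f s as ≡ (s , as)
mapAccumˡ-id         eq []       = refl
mapAccumˡ-id {f = f} {s} eq (a ∷ as) rewrite eq a | mapAccumˡ-id {f = f} {s} eq as = refl

mapAccumʳ-id : ∀ {A S : Set} {f : S → A → S × A} {s} → (∀ a → f s a ≡ (s , a)) → ∀ as → mapAccumʳ f s as ≡ (s , as)
mapAccumʳ-id         eq []       = refl
mapAccumʳ-id {f = f} {s} eq (a ∷ as) rewrite mapAccumʳ-id {f = f} {s} eq as | eq a = refl

-- The return pass shifts every value one cell to the left. What falls off at the home position is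
-- the head of the queue, and it becomes the exit.
dequeue : Sweep
dequeue = record
  { init = nothing ; forth = _,_ ; append = λ _ → nothing ; turn = λ _ → nothing ; back = λ s v → v , s }

private
  shift : ∀ {vs bs} → Contents vs bs →
          let (s , vs′) = mapAccumʳ (Sweep.back dequeue) nothing vs in Contents (s ∷ vs′) bs
  shift ([] [])          = [] (refl ∷ [])
  shift ([] (refl ∷ ns)) with shift ([] ns)
  ... | [] ns′ = [] (refl ∷ ns′)
  shift (b ∷ cs)         = b ∷ shift cs

  dequeue-forth : ∀ vs → proj₂ (mapAccumˡ (Sweep.forth dequeue) nothing vs) ≡ vs
  dequeue-forth vs = cong proj₂ (mapAccumˡ-id {f = Sweep.forth dequeue} (λ _ → refl) vs)

dequeue-[] : Sweeps dequeue [] nothing []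
dequeue-[] {vs} cs rewrite dequeue-forth vs with shift cs
... | [] (eq ∷ ns) = eq , contents-++ ([] ns) []

dequeue-∷ : ∀ b bs → Sweeps dequeue (b ∷ bs) (just b) bs
dequeue-∷ b bs {vs} cs rewrite dequeue-forth vs with cs
... | b ∷ cs′ = refl , contents-++ (shift cs′) []

private
  -- The bit is carried to the first free cell of its track. If there is none, it is still in the
  -- state at the right end, where `append = id` makes a new cell for it.
  deposit : Value → Value → Value × Value
  deposit (just b) nothing = nothing , just b
  deposit s        v       = s , v

enqueue : Bool → Sweep
enqueue b = record
  { init = just b ; forth = deposit ; append = id ; turn = λ _ → nothing ; back = _,_ }

enqueue-sweeps : ∀ b bs → Sweeps (enqueue b) bs nothing (bs ++ b ∷ [])
enqueue-sweeps b bs {vs} cs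
  rewrite mapAccumʳ-id {f = Sweep.back (enqueue b)} {s = nothing} (λ _ → refl) (proj₂ (mapAccumˡ deposit
      (just b) vs)) = refl , go cs
  where
  go : ∀ {vs bs} → Contents vs bs →
       let (s , vs′) = mapAccumˡ deposit (just b) vs in Contents (vs′ ++ appended s) (bs ++ b ∷ [])
  go ([] [])                     = b ∷ [] []
  go ([] {nothing ∷ vs} (refl ∷ ns))
    rewrite mapAccumˡ-id {f = deposit} {s = nothing} (λ _ → refl) vs = b ∷ contents-++ ([] ns) []
  go (c ∷ cs)                    = c ∷ go cs

-- Loop counters are binary tracks of constant length: a tick turns the first false into true, or, when
-- there is none, resets the track.
tick : Sweep
tick = record { init = nothing ; forth = mark ; append = λ _ → nothing ; turn = id ; back = reset }
  where
  mark reset : Value → Value → Value × Value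
  mark nothing (just false) = just true , just true
  mark s       v            = s , v
  reset nothing (just true) = nothing , just false
  reset s       v           = s , v

open Sweep

private
  tick-forth : ∀ m {bs vs} → Contents vs (replicate m true ++ false ∷ bs) →
    let (s , vs′) = mapAccumˡ (forth tick) nothing vs in
    s ≡ just true × Contents vs′ (replicate m true ++ true ∷ bs)
  tick-forth zero (_∷_ false {vs} cs)
    rewrite mapAccumˡ-id {f = forth tick} {s = just true} (λ _ → refl) vs = refl , true ∷ cs
  tick-forth (suc m) (true ∷ cs) = proj₁ (tick-forth m cs) , true ∷ proj₂ (tick-forth m cs)

  reset-forth : ∀ m {vs} → Contents vs (replicate m true) → mapAccumˡ (forth tick) nothing vs ≡ (nothing , vs)
  reset-forth zero    ([] [])          = refl
  reset-forth zero    ([] (refl ∷ ns)) rewrite reset-forth zero ([] ns) = refl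
  reset-forth (suc m) (true ∷ cs)      rewrite reset-forth m cs = refl

  reset-back : ∀ m {vs} → Contents vs (replicate m true) →
    let (s , vs′) = mapAccumʳ (back tick) nothing vs in s ≡ nothing × Contents vs′ (replicate m false)
  reset-back zero    ([] [])          = refl , [] []
  reset-back zero    ([] {nothing ∷ vs} (refl ∷ ns)) with mapAccumʳ (back tick) nothing vs | reset-back zero ([] ns)
  ... | _ , vs′ | refl , [] ns′ = refl , [] (refl ∷ ns′)
  reset-back (suc m) (_∷_ true {vs} cs) with mapAccumʳ (back tick) nothing vs | reset-back m cs
  ... | _ , vs′ | refl , cs′ = refl , false ∷ cs′

tick-sweeps : ∀ m bs → Sweeps tick (replicate m true ++ false ∷ bs) (just true) (replicate m true ++ true ∷ bs)
tick-sweeps m bs {vs} cs with mapAccumˡ (forth tick) nothing vs | tick-forth m cs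
... | _ , vs′ | refl , cs′
  rewrite mapAccumʳ-id {f = back tick} {s = just true} (λ _ → refl) vs′ = refl , contents-++ cs′ []

-- The failing tick leaves the counter ready for reuse, so an inner loop can run again in the next
-- iteration of an outer one.
tick-resets : ∀ m → Sweeps tick (replicate m true) nothing (replicate m false)
tick-resets m cs rewrite reset-forth m cs = proj₁ (reset-back m cs) , contents-++ (proj₂ (reset-back m cs)) []

-- Queue programs

-- Programs over k queues of bits, with loops nested at most c deep. Every loop makes as many iterations
-- as the input has bits, so a program cannot help running in polynomial time.
data Cmd (k : ℕ) : ℕ → Set where
  skip abort : ∀ {c} → Cmd k c
  enq        : ∀ {c} → Fin k → Bool → Cmd k c
  deq        : ∀ {c} → Fin k → Cmd k c → (Bool → Cmd k c) → Cmd k c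
  _⨟_        : ∀ {c} → Cmd k c → Cmd k c → Cmd k c
  loop       : ∀ {c} → Cmd k c → Cmd k (suc c)

infixr 5 _⨟_

State : ℕ → Set
State k = Vec (List Bool) k

iterate : ∀ {A : Set} → ℕ → (A → Maybe A) → A → Maybe A
iterate zero    f a = just a
iterate (suc n) f a = f a >>= iterate n f

module _ (N : ℕ) where

  ⟦_⟧ : ∀ {k c} → Cmd k c → State k → Maybe (State k)
  ⟦deq⟧ : ∀ {k c} → Fin k → Cmd k c → (Bool → Cmd k c) → State k → List Bool → Maybe (State k)

  ⟦ skip ⟧      σ = just σ
  ⟦ abort ⟧     σ = nothing
  ⟦ enq i b ⟧   σ = just (σ [ i ]≔ (lookup σ i ++ b ∷ []))
  ⟦ deq i e f ⟧ σ = ⟦deq⟧ i e f σ (lookup σ i)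
  ⟦ p ⨟ q ⟧     σ = ⟦ p ⟧ σ >>= ⟦ q ⟧
  ⟦ loop p ⟧    σ = iterate N ⟦ p ⟧ σ

  ⟦deq⟧ i e f σ []       = ⟦ e ⟧ σ
  ⟦deq⟧ i e f σ (b ∷ bs) = ⟦ f b ⟧ (σ [ i ]≔ bs)

  -- One number bounds both the sweeps made and the cells added, since a sweep adds at most one
  -- cell. A `deq` is charged for all its branches; the extra 1 of `⨟` pays for passing on a
  -- rejection, and that of `loop` for the last, failing tick.
  cost : ∀ {k c} → Cmd k c → ℕ
  cost skip        = 1
  cost abort       = 1
  cost (enq _ _)   = 1
  cost (deq _ e f) = 1 + (cost e + (cost (f false) + cost (f true)))
  cost (p ⨟ q)     = cost p + (cost q + 1)
  cost (loop p)    = 1 + N * (1 + cost p)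

module Compile (k D : ℕ) (input : Bool → Vec Value (k + D)) where
  open Tracks (k + D) input public

  queue : Fin k → Fin (k + D)
  queue i = i ↑ˡ D

  counter : Fin D → Fin (k + D)
  counter j = k ↑ʳ j

  queue≢counter : ∀ {i j} → queue i ≢ counter j
  queue≢counter {i} {j} eq with trans (Eq.sym (splitAt-↑ˡ k i D)) (trans (cong (splitAt k) eq) (splitAt-↑ʳ k D j))
  ... | ()

  -- The nesting depth in the type allocates the counters: a loop whose body has depth `c` owns
  -- counter `c`, and loops inside it own smaller ones. Loops in sequence can share a counter
  -- because it is reset at the end.
  compile : ∀ {c} → c ≤ D → Cmd k c → Machine
  compile p skip        = return nothing
  compile p abort       = return (just false)
  compile p (enq i b)   = sweeper (queue i) (enqueue b)
  compile p (deq i e f) = bind (sweeper (queue i) dequeue) (maybe′ (λ b → compile p (f b)) (compile p e))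
  compile p (a ⨟ b)     = bind (compile p a) (maybe′ (λ _ → return (just false)) (compile p b))
  compile p (loop a)    = while (sweeper (counter (fromℕ< p)) tick) (compile (<⇒≤ p) a)

  record Represents (w : List Cell) (σ : State k) (κ : Vec (List Bool) D) : Set where
    field
      queues   : ∀ i → Contents (column (queue i) w) (lookup σ i)
      counters : ∀ j → Contents (column (counter j) w) (lookup κ j)
  open Represents

  module _ {o : Sweep} {w : List Cell} {v : Value} {bs : List Bool} {gs : List Γ} {σ : State k} {κ : Vec (List Bool) D}
    (R : Represents w σ κ) where

    queue-swept : ∀ {i} (S : Swept (queue i) o gs w v bs) → Represents (Swept.w′ S) (σ [ i ]≔ bs) κ
    queue-swept {i} S = record
      { queues = go
      ; counters = λ j → Swept.kept S (queue≢counter ∘ Eq.sym) (counters R j) }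
      where
      go : ∀ j → Contents (column (queue j) (Swept.w′ S)) (lookup (σ [ i ]≔ bs) j)
      go j with i ≟ j
      ... | yes refl = subst (Contents _) (Eq.sym (lookup∘update i σ bs)) (Swept.swept S)
      ... | no i≢j = subst (Contents _) (Eq.sym (lookup∘update′ (i≢j ∘ Eq.sym) σ bs))
        (Swept.kept S (i≢j ∘ Eq.sym ∘ ↑ˡ-injective D j i) (queues R j))

    counter-swept : ∀ {i} (S : Swept (counter i) o gs w v bs) → Represents (Swept.w′ S) σ (κ [ i ]≔ bs)
    counter-swept {i} S = record
      { queues = λ j → Swept.kept S queue≢counter (queues R j)
      ; counters = go }
      where
      go : ∀ j → Contents (column (counter j) (Swept.w′ S)) (lookup (κ [ i ]≔ bs) j)
      go j with i ≟ j
      ... | yes refl = subst (Contents _) (Eq.sym (lookup∘update i κ bs)) (Swept.swept S)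
      ... | no i≢j = subst (Contents _) (Eq.sym (lookup∘update′ (i≢j ∘ Eq.sym) κ bs))
        (Swept.kept S (i≢j ∘ Eq.sym ∘ ↑ʳ-injective k j i) (counters R j))

  module Correctness (N L : ℕ) where

    -- The time of one sweep while the tape has at most `L` cells.
    S : ℕ
    S = 3 + (L + L)

    -- Counters from `c` upwards may belong to enclosing loops that are under way, so nothing is
    -- asked of them.
    Fresh : ℕ → Vec (List Bool) D → Set
    Fresh c κ = ∀ j → toℕ j < c → lookup κ j ≡ replicate N false

    -- On `done` the counters are as they were found, so an enclosing loop keeps its place. After a
    -- rejection only the time and the home position of the head matter, as the tape is no longer
    -- consulted.
    data Outcome (M : Machine) (gs : List Γ) (w : List Cell) (κ : Vec (List Bool) D) (b : ℕ) :
                 Maybe (State k) → Set where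
      done     : ∀ {t gs′ w′ σ} → Run M (start M) (rest gs) t nothing (rest gs′) → gs′ Reads w′ →
                 Represents w′ σ κ → length w′ ≤ length w + b → t ≤ b * S → Outcome M gs w κ b (just σ)
      rejected : ∀ {t d gs′} → Run M (start M) (rest gs) t (just d) (rest gs′) → t ≤ b * S →
                 Outcome M gs w κ b nothing

    weaken : ∀ {M gs w κ b b′ m} → b ≤ b′ → Outcome M gs w κ b m → Outcome M gs w κ b′ m
    weaken {w = w} le (done r rd R l t) =
      done r rd R (≤-trans l (+-monoʳ-≤ (length w) le)) (≤-trans t (*-monoˡ-≤ S le))
    weaken le (rejected r t) = rejected r (≤-trans t (*-monoˡ-≤ S le))

    private
      time-+ : ∀ {t t′} b b′ → t ≤ b * S → t′ ≤ b′ * S → t + t′ ≤ (b + b′) * S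
      time-+ b b′ p q = ≤-trans (+-mono-≤ p q) (≤-reflexive (Eq.sym (*-distribʳ-+ S b b′)))

      length-+ : ∀ {l l′ l″} b b′ → l′ ≤ l + b → l″ ≤ l′ + b′ → l″ ≤ l + (b + b′)
      length-+ {l} b b′ p q = ≤-trans q (≤-trans (+-monoˡ-≤ b′ p) (≤-reflexive (+-assoc l b b′)))

    bind-outcome : ∀ {M} {F : Exit → Machine} {gs gs′ t x w w′ κ b b′ m} → Run M (start M) (rest gs) t x
        (rest gs′) → t ≤ b * S →
                   length w′ ≤ length w + b → Outcome (F x) gs′ w′ κ b′ m → Outcome (bind M F) gs w κ (b + b′) m
    bind-outcome {M} {F} {b = b} {b′} r t l (done r′ rd R l′ t′) =
      done (bind-run M F r r′) rd R (length-+ b b′ l l′) (time-+ b b′ t t′)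
    bind-outcome {M} {F} {b = b} {b′} r t l (rejected r′ t′) = rejected (bind-run M F r r′) (time-+ b b′ t t′)

    budget : ∀ {l l′} b b′ → l′ ≤ l + b → l + (b + b′) ≤ L → l′ + b′ ≤ L
    budget {l} b b′ p q = ≤-trans (+-monoˡ-≤ b′ p) (≤-trans (≤-reflexive (+-assoc l b b′)) q)

    sweep-time : ∀ {w o i gs v bs} (Z : Swept i o gs w v bs) → length w ≤ L → Swept.time Z ≤ 1 * S
    sweep-time Z l = ≤-trans (Swept.time-≤ Z) (≤-trans (+-monoʳ-≤ 3 (+-mono-≤ l l)) (≤-reflexive (Eq.sym
        (*-identityˡ S))))

    sweep-length : ∀ {w o i gs v bs} (Z : Swept i o gs w v bs) → length (Swept.w′ Z) ≤ length w + 1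
    sweep-length {w} Z = ≤-trans (Swept.length-≤ Z) (≤-reflexive (Eq.sym (+-comm (length w) 1)))

    return-time : 1 ≤ 1 * S
    return-time = s≤s z≤n

    replicate-shift : ∀ m {bs} → replicate m true ++ true ∷ bs ≡ replicate (suc m) true ++ bs
    replicate-shift zero    = refl
    replicate-shift (suc m) = cong (true ∷_) (replicate-shift m)

    correct : ∀ {c} (p : c ≤ D) (C : Cmd k c) {gs w σ κ} → gs Reads w → Represents w σ κ → Fresh c κ →
              length w + cost N C ≤ L → Outcome (compile p C) gs w κ (cost N C) (⟦_⟧ N C σ)
    correct p skip  {w = w} rd R F l = done (return-run nothing _) rd R (m≤m+n (length w) 1) return-time
    correct p abort rd R F l = rejected (return-run (just false) _) return-time
    correct p (enq i b) {w = w} {σ} rd R F l =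
      done (Swept.running Z) (Swept.reads Z) (queue-swept R Z) (sweep-length Z) (sweep-time Z (m+n≤o⇒m≤o (length w) l))
      where Z = sweeper-correct (queue i) (enqueue b) (enqueue-sweeps b (lookup σ i)) rd (queues R i)
    correct p (deq i e f) {w = w} {σ} rd R F l with lookup σ i in eq
    ... | [] = weaken (s≤s ce≤) (bind-outcome {sweeper (queue i) dequeue} {maybe′ (λ b → compile p (f b))
        (compile p e)} {b = 1} (Swept.running Z) (sweep-time Z (m+n≤o⇒m≤o (length w) l)) (sweep-length Z)
          (correct p e (Swept.reads Z) R′ F (budget 1 _ (sweep-length Z) (≤-trans (+-monoʳ-≤ (length w) (s≤s ce≤)) l))))
      where
      ce≤ = m≤m+n (cost N e) (cost N (f false) + cost N (f true))
      Z = sweeper-correct (queue i) dequeue dequeue-[] rd (subst (Contents _) eq (queues R i))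
      R′ : Represents (Swept.w′ Z) σ _
      R′ = subst (λ σ′ → Represents (Swept.w′ Z) σ′ _)
        (trans (cong (σ [ i ]≔_) (Eq.sym eq)) ([]≔-lookup σ i)) (queue-swept R Z)
    ... | b ∷ bs = weaken (s≤s (cf≤ b)) (bind-outcome {sweeper (queue i) dequeue} {maybe′ (λ b → compile p (f b))
        (compile p e)} {b = 1} (Swept.running Z) (sweep-time Z (m+n≤o⇒m≤o (length w) l)) (sweep-length Z)
          (correct p (f b) (Swept.reads Z) (queue-swept R Z) F
            (budget 1 _ (sweep-length Z) (≤-trans (+-monoʳ-≤ (length w) (s≤s (cf≤ b))) l))))
      where
      cf≤ : ∀ b → cost N (f b) ≤ cost N e + (cost N (f false) + cost N (f true))
      cf≤ false = ≤-trans (m≤m+n _ _) (m≤n+m _ (cost N e))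
      cf≤ true  = ≤-trans (m≤n+m _ (cost N (f false))) (m≤n+m _ (cost N e))
      Z = sweeper-correct (queue i) dequeue (dequeue-∷ b bs) rd (subst (Contents _) eq (queues R i))
    correct p (A ⨟ B) {w = w} {σ} rd R F l
      with ⟦_⟧ N A σ | correct p A rd R F (≤-trans (+-monoʳ-≤ (length w) (m≤m+n (cost N A) (cost N B + 1))) l)
    ... | nothing | rejected r t = rejected (bind-run (compile p A) (maybe′ (λ _ → return (just false))
        (compile p B)) r (return-run (just false) _))
          (time-+ (cost N A) (cost N B + 1) t (≤-trans return-time (*-monoˡ-≤ S (m≤n+m 1 (cost N B)))))
    ... | just σ′ | done r rd′ R′ l′ t = bind-outcome {compile p A} {maybe′ (λ _ → return (just false))
        (compile p B)} r t l′ (weaken (m≤m+n _ 1) (correct p B rd′ R′ F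
          (budget (cost N A) (cost N B) l′
            (≤-trans (+-monoʳ-≤ (length w) (+-monoʳ-≤ (cost N A) (m≤m+n (cost N B) 1))) l))))
    correct {suc c} p (loop A) {κ = κ} rd R F l =
      go N 0 refl rd (subst (Represents _ _) (Eq.sym κ-j) R) l
      where
      j = fromℕ< p
      b = cost N A
      W₁ = sweeper (counter j) tick
      W₂ = compile (<⇒≤ p) A
      while′ = while W₁ W₂

      j-fresh : lookup κ j ≡ replicate N false
      j-fresh = F j (≤-reflexive (cong suc (toℕ-fromℕ< p)))

      κ-j : κ [ j ]≔ replicate N false ≡ κ
      κ-j = trans (cong (κ [ j ]≔_) (Eq.sym j-fresh)) ([]≔-lookup κ j)

      F′ : ∀ bs → Fresh c (κ [ j ]≔ bs)
      F′ bs i i<c = trans (lookup∘update′ (λ { refl → <-irrefl (toℕ-fromℕ< p) i<c }) κ bs) (F i (m≤n⇒m≤1+n i<c))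

      -- There have been `m` ticks and `r` iterations remain; the counter track shows exactly this.
      go : ∀ r m {gs w σ} → m + r ≡ N → gs Reads w →
           Represents w σ (κ [ j ]≔ (replicate m true ++ replicate r false)) → length w + (1 + r * (1 + b)) ≤ L →
           Outcome while′ gs w κ (1 + r * (1 + b)) (iterate r (⟦_⟧ N A) σ)
      go zero m {w = w} eq rd R l =
        done (while-end W₁ W₂ (Swept.running Z)) (Swept.reads Z) (subst (Represents _ _) κ-reset (counter-swept R Z))
          (sweep-length Z) (sweep-time Z (m+n≤o⇒m≤o (length w) l))
        where
        Z = sweeper-correct (counter j) tick (tick-resets m) rd
          (subst (Contents _) (trans (lookup∘update j κ _) (++-identityʳ _)) (counters R j))
        κ-reset : (κ [ j ]≔ (replicate m true ++ [])) [ j ]≔ replicate m false ≡ κ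
        κ-reset rewrite trans (Eq.sym (+-identityʳ m)) eq = trans ([]≔-idempotent κ j) κ-j
      go (suc r) m {gs} {w} {σ} eq rd R l = again (correct (<⇒≤ p) A (Swept.reads Z) R₁ (F′ _) (budget 1 b
          (sweep-length Z) lb))
        where
        Z = sweeper-correct (counter j) tick (tick-sweeps m (replicate r false)) rd
          (subst (Contents _) (lookup∘update j κ _) (counters R j))
        t₀ = sweep-time Z (m+n≤o⇒m≤o (length w) l)
        R₁ = subst (Represents _ _) ([]≔-idempotent κ j) (counter-swept R Z)
        lb : length w + (1 + b) ≤ L
        lb = ≤-trans (+-monoʳ-≤ (length w) (≤-trans (m≤m+n (1 + b) (r * (1 + b))) (n≤1+n _))) l
        c₁ = 1 + b
        c₂ = 1 + r * (1 + b)
        total : c₁ + c₂ ≡ 1 + suc r * (1 + b)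
        total = +-suc c₁ (r * (1 + b))
        again : ∀ {m′} → Outcome W₂ (Swept.gs′ Z) (Swept.w′ Z) (κ [ j ]≔
            (replicate m true ++ true ∷ replicate r false)) b m′ →
                Outcome while′ gs w κ (1 + suc r * (1 + b)) (m′ >>= iterate r (⟦_⟧ N A))
        again (rejected run t) = rejected (while-break W₁ W₂ (Swept.running Z) run)
          (≤-trans (time-+ 1 b t₀ t) (*-monoˡ-≤ S (≤-trans (m≤m+n c₁ c₂) (≤-reflexive total))))
        again (done {w′ = w″} run rd′ R′ l′ t) = weaken (≤-reflexive total) (prefix (go r (suc m)
            (trans (Eq.sym (+-suc m r)) eq) rd′
            (subst (λ bs → Represents w″ _ (κ [ j ]≔ bs)) (replicate-shift m) R′)
            (budget c₁ c₂ l₁ (subst (λ n → length w + n ≤ L) (Eq.sym total) l))))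
          where
          l₁ = length-+ 1 b (sweep-length Z) l′
          prefix : ∀ {m} → Outcome while′ _ w″ κ c₂ m → Outcome while′ gs w κ (c₁ + c₂) m
          prefix (done run′ rd R l t′) = done (while-again W₁ W₂ (Swept.running Z) run run′) rd R (length-+ c₁ c₂ l₁ l)
            (time-+ 1 (b + c₂) t₀ (time-+ b c₂ t t′))
          prefix (rejected run′ t′) = rejected (while-again W₁ W₂ (Swept.running Z) run run′)
            (time-+ 1 (b + c₂) t₀ (time-+ b c₂ t t′))

-- From the input word to the output word

module Program (k D : ℕ) where

  -- The input is the initial content of queue zero. One `false` per input bit on each counter track
  -- is what makes every loop run as often as the input has bits.
  input : Bool → Vec Value (suc k + D)
  input b = (just b ∷ Vec.replicate k nothing) Vec.++ Vec.replicate D (just false)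

  open Compile (suc k) D input

  data OutQ : Set where
    starting copying returning : OutQ

  OutQ-finite : Finite OutQ
  OutQ-finite = record
    { size = 3
    ; enc = λ { starting → zero ; copying → suc zero ; returning → suc (suc zero) }
    ; dec = λ { zero → starting ; (suc zero) → copying ; (suc (suc _)) → returning }
    ; dec-enc = λ { starting → refl ; copying → refl ; returning → refl } }

  private
    copy : Γ → Maybe Value → (OutQ ⊎ Exit) × Γ × Move
    copy g (just (just b)) = inj₁ copying , bit b , right
    copy g (just nothing)  = inj₁ returning , g , left
    copy g nothing         = inj₁ returning , g , left

    first : Γ → Maybe Value
    first g = Maybe.map (λ c → lookup c zero) (toCell g)

    first-eq : ∀ {g c} → toCell g ≡ just c → first g ≡ just (lookup c zero)
    first-eq eq = cong (Maybe.map (λ c → lookup c zero)) eq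

    out-δ : OutQ → Γ → (OutQ ⊎ Exit) × Γ × Move
    out-δ starting   g     = inj₁ copying , g , right
    out-δ copying   g     = copy g (first g)
    -- Output is read from the head onwards, so the head has to end on the first bit and not on the
    -- home blank.
    out-δ returning blank = inj₂ nothing , blank , right
    out-δ returning g     = inj₁ returning , g , left

  outputter : Machine
  outputter = record { Q = OutQ ; Q-finite = OutQ-finite ; start = starting ; δ = out-δ }

  private
    output-return : ∀ bs {ls gs t x T} → Run outputter returning (enterˡ ls (map bit bs ++ gs)) t x T →
                    Run outputter returning (enterˡ (map bit bs ʳ++ ls) gs) (length bs + t) x T
    output-return []       r = r
    output-return (b ∷ bs) {ls} {gs} {t} {x} {T} r =
      subst (λ n → Run outputter returning (enterˡ (map bit bs ʳ++ (bit b ∷ ls)) gs) n x T)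
        (+-suc (length bs) t) (output-return bs {bit b ∷ ls} {gs} (step refl r))

    output-copy : ∀ {gs w bs} → gs Reads w → Contents (column zero w) bs → ∃ λ gs′ → readΓ gs′ ≡ [] ×
      (∀ {ls t x T} → Run outputter returning (enterˡ (map bit bs ʳ++ ls) gs′) t x T →
                      Run outputter copying (enter ls gs) (length bs + suc t) x T)
    output-copy {[]}     ([] [])            ([] _) = blank ∷ [] , refl , step refl
    output-copy {g ∷ gs} ([] (refl ∷ _))    ([] _) = blank ∷ gs , refl , step refl
    output-copy {g ∷ gs} {(v ∷ c) ∷ w} (eq ∷ rd) ([] (refl ∷ _)) = g ∷ gs , unread g eq , step (cong (copy g)
        (first-eq eq))
      where
      -- A raw input bit always shows a value on track zero. Copying therefore stops at a proper
      -- cell, which cannot be mistaken for a further output bit.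
      unread : ∀ g → toCell g ≡ just (nothing ∷ c) → readΓ (g ∷ gs) ≡ []
      unread (cell _) _ = refl
    output-copy {g ∷ gs} {(v ∷ c) ∷ w} (eq ∷ rd) (b ∷ cs) =
      let (gs′ , eq′ , k) = output-copy rd cs in
      gs′ , eq′ , λ r → step (cong (copy g) (first-eq eq)) (k r)

    Contents-length : ∀ {vs bs} → Contents vs bs → length bs ≤ length vs
    Contents-length ([] _)   = z≤n
    Contents-length (b ∷ cs) = s≤s (Contents-length cs)

    readΓ-++ : ∀ bs {gs} → readΓ gs ≡ [] → readΓ (map bit bs ++ gs) ≡ bs
    readΓ-++ []       eq = eq
    readΓ-++ (b ∷ bs) eq = cong (b ∷_) (readΓ-++ bs eq)

    scanned-enter : ∀ ls gs → scanned (enter ls gs) ≡ readΓ gs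
    scanned-enter ls []       = refl
    scanned-enter ls (g ∷ gs) = refl

  outputter-correct : ∀ {gs w bs} → gs Reads w → Contents (column zero w) bs → ∃ λ T → scanned T ≡ bs ×
                      ∃ λ t → Run outputter starting (rest gs) t nothing T × t ≤ 3 + (length w + length w)
  outputter-correct {w = w} {bs} rd cs =
    let (gs′ , eq , k) = output-copy rd cs in
    _ , trans (scanned-enter (blank ∷ []) (map bit bs ++ gs′)) (readΓ-++ bs eq) , _ ,
    step refl (k (output-return bs {blank ∷ []} {gs′} (stop refl))) , time

    where
    open ≤-Reasoning hiding (stop)
    bs≤w : length bs ≤ length w
    bs≤w = ≤-trans (Contents-length cs) (≤-reflexive (length-map _ w))
    time : suc (length bs + suc (length bs + 1)) ≤ 3 + (length w + length w)
    time = begin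
      suc (length bs + suc (length bs + 1)) ≡⟨ arith (length bs) ⟩
      3 + (length bs + length bs)           ≤⟨ +-monoʳ-≤ 3 (+-mono-≤ bs≤w bs≤w) ⟩
      3 + (length w + length w)             ∎
      where
      arith : ∀ n → suc (n + suc (n + 1)) ≡ 3 + (n + n)
      arith = solve-∀

  load : Machine
  load = record { Q = ⊤ ; Q-finite = ⊤-finite ; start = tt ; δ = λ _ g → inj₂ nothing , g , left }

  initial : List Bool → State (suc k)
  initial w = w ∷ Vec.replicate k []

  -- The value of an aborted program is the empty word, which is not the encoding of any graph.
  eval : Cmd (suc k) D → List Bool → List Bool
  eval C w = maybe′ (λ σ → lookup σ zero) [] (⟦_⟧ (length w) C (initial w))

  wrap : Machine → Machine
  wrap M = bind load (λ _ → bind M (maybe′ (λ b → return (just b)) outputter))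

  machine : Cmd (suc k) D → Machine
  machine C = wrap (compile ≤-refl C)

  -- One step for `load`, and one sweep on top of `cost` for writing the output.
  steps : Cmd (suc k) D → ℕ → ℕ
  steps C n = 1 + ((cost n C + 1) * (3 + (L + L)))
    where L = n + cost n C

  loaded : List Bool → List Γ
  loaded []       = blank ∷ []
  loaded (b ∷ bs) = map bit (b ∷ bs)

  load-run : ∀ w → Run load tt (enter [] (map bit w)) 1 nothing (rest (loaded w))
  load-run []      = stop refl
  load-run (b ∷ w) = stop refl

  module _ {M : Machine} {w : List Bool} where
    private
      F : Exit → Machine
      F = maybe′ (λ b → return (just b)) outputter

      load-then : ∀ {t x T} → Run (bind M F) (start (bind M F)) (rest (loaded w)) t x T →
                  Run (wrap M) (start (wrap M)) (enter [] (map bit w)) (1 + t) x T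
      load-then = bind-run load (λ _ → bind M F) (load-run w)

    wrap-done : ∀ {t gs t′ x T} → Run M (start M) (rest (loaded w)) t nothing (rest gs) →
                Run outputter starting (rest gs) t′ x T →
                Run (wrap M) (start (wrap M)) (enter [] (map bit w)) (1 + (t + t′)) x T
    wrap-done r r′ = load-then (bind-run M F r r′)

    wrap-rejected : ∀ {t b gs} → Run M (start M) (rest (loaded w)) t (just b) (rest gs) →
                    Run (wrap M) (start (wrap M)) (enter [] (map bit w)) (1 + (t + 1)) (just b) (rest gs)
    wrap-rejected {b = b} {gs} r = load-then (bind-run M F r (return-run (just b) (rest gs)))

  loaded-reads : ∀ w → loaded w Reads map input w
  loaded-reads []      = [] (refl ∷ [])
  loaded-reads (b ∷ w) = refl ∷ go w
    where
    go : ∀ w → map bit w Reads map input w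
    go []      = [] []
    go (b ∷ w) = refl ∷ go w

  loaded-represents : ∀ w → Represents (map input w) (initial w) (Vec.replicate D (replicate (length w) false))
  loaded-represents w = record { queues = qs ; counters = cs }
    where
    first-queue : ∀ w → Contents (column zero (map input w)) w
    first-queue []      = [] []
    first-queue (b ∷ w) = b ∷ first-queue w

    qs : ∀ i → Contents (column (queue i) (map input w)) (lookup (initial w) i)
    qs zero = first-queue w
    qs (suc i) rewrite lookup-replicate {A = List Bool} i [] = [] (go w)
      where
      go : ∀ w → All (_≡ nothing) (column (queue (suc i)) (map input w))
      go []      = []
      go (b ∷ w) = trans (lookup-++ˡ (Vec.replicate k nothing) _ i) (lookup-replicate i nothing) ∷ go w

    cs : ∀ j → Contents (column (counter j) (map input w)) (lookup (Vec.replicate D (replicate (length w) false)) j)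
    cs j rewrite lookup-replicate j (replicate (length w) false) = go w
      where
      go : ∀ w → Contents (column (counter j) (map input w)) (replicate (length w) false)
      go []      = [] []
      go (b ∷ w) rewrite lookup-++ʳ (Vec.replicate k nothing) (Vec.replicate D (just false)) j
                       | lookup-replicate {A = Value} j (just false) = false ∷ go w

  machine-correct : ∀ C w → ∃ λ T → scanned T ≡ eval C w × ∃ λ t → ∃ λ x →
                    Run (machine C) (start (machine C)) (enter [] (map bit w)) t x T × t ≤ steps C (length w)
  machine-correct C w = conclude (correct N L ≤-refl C (loaded-reads w) (loaded-represents w)
      (λ j _ → lookup-replicate j (replicate N false)) (≤-reflexive (cong (_+ cost N C) (length-map input w))))
    where
    open Correctness hiding (correct)
    open Correctness using (correct)
    N = length w
    L = N + cost N C
    body = compile ≤-refl C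
    time : ∀ {t t′} → t ≤ cost N C * S N L → t′ ≤ 3 + (L + L) → 1 + (t + t′) ≤ steps C N
    time p q = s≤s (≤-trans (+-mono-≤ p (≤-trans q (≤-reflexive (Eq.sym (*-identityˡ (S N L))))))
      (≤-reflexive (Eq.sym (*-distribʳ-+ (S N L) (cost N C) 1))))

    conclude : ∀ {m} → Outcome N L body (loaded w) (map input w) (Vec.replicate D (replicate N false)) (cost N C) m →
               ∃ λ T → scanned T ≡ maybe′ (λ σ → lookup σ zero) [] m × ∃ λ t → ∃ λ x →
               Run (machine C) (start (machine C)) (enter [] (map bit w)) t x T × t ≤ steps C N
    conclude (done {w′ = w′} r rd R l t) with outputter-correct rd (Represents.queues R zero)
    ... | T , eq , t′ , r′ , le = T , eq , _ , _ , wrap-done r r′ ,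
      time t (≤-trans le (+-monoʳ-≤ 3 (+-mono-≤ l′ l′)))
      where
      l′ : length w′ ≤ L
      l′ = ≤-trans l (≤-reflexive (cong (_+ cost N C) (length-map input w)))
    -- The head is on the home blank, so the tape scans as the empty word.
    conclude (rejected {d = d} {gs′} r t) = _ , refl , _ , _ ,
      wrap-rejected r , time t (s≤s z≤n)

-- Polynomial bounds

Polynomial : (ℕ → ℕ) → Set
Polynomial g = ∃ λ a → ∃ λ d → ∀ n → g n ≤ a * suc n ^ d

^-distribʳ-* : ∀ d m n → (m * n) ^ d ≡ m ^ d * n ^ d
^-distribʳ-* zero    m n = refl
^-distribʳ-* (suc d) m n = trans (cong (m * n *_) (^-distribʳ-* d m n)) (interchange m n (m ^ d) (n ^ d))
  where
  interchange : ∀ m n x y → m * n * (x * y) ≡ m * x * (n * y)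
  interchange = solve-∀

private
  -- This is the purpose of the base `suc n` in `Polynomial`: it is positive also for `n = 0`, so
  -- exponents can always be raised to a common value.
  ^-weaken : ∀ a {m d e} → d ≤ e → a * suc m ^ d ≤ a * suc m ^ e
  ^-weaken a {m} le = *-monoʳ-≤ a (^-monoʳ-≤ (suc m) le)

Polynomial-const : ∀ c → Polynomial (λ _ → c)
Polynomial-const c = c , 0 , λ n → ≤-reflexive (Eq.sym (*-identityʳ c))

Polynomial-id : Polynomial id
Polynomial-id = 1 , 1 , λ n → ≤-trans (n≤1+n n) (≤-reflexive (Eq.sym (trans (*-identityˡ _) (*-identityʳ (suc n)))))

Polynomial-+ : ∀ {f g} → Polynomial f → Polynomial g → Polynomial (λ n → f n + g n)
Polynomial-+ (a , d , p) (b , e , q) = a + b , d + e , λ n → ≤-trans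
  (+-mono-≤ (≤-trans (p n) (^-weaken a (m≤m+n d e))) (≤-trans (q n) (^-weaken b (m≤n+m e d))))
  (≤-reflexive (Eq.sym (*-distribʳ-+ (suc n ^ (d + e)) a b)))

Polynomial-* : ∀ {f g} → Polynomial f → Polynomial g → Polynomial (λ n → f n * g n)
Polynomial-* (a , d , p) (b , e , q) = a * b , d + e , λ n → ≤-trans (*-mono-≤ (p n) (q n))
  (≤-reflexive (trans (interchange a (suc n ^ d) b (suc n ^ e)) (cong (a * b *_) (Eq.sym (^-distribˡ-+-* (suc n) d e)))))
  where
  interchange : ∀ a x b y → a * x * (b * y) ≡ a * b * (x * y)
  interchange = solve-∀

Polynomial-cost : ∀ {k c} (C : Cmd k c) → Polynomial (λ n → cost n C)
Polynomial-cost skip        = Polynomial-const 1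
Polynomial-cost abort       = Polynomial-const 1
Polynomial-cost (enq _ _)   = Polynomial-const 1
Polynomial-cost (deq _ e f) = Polynomial-+ (Polynomial-const 1)
  (Polynomial-+ (Polynomial-cost e) (Polynomial-+ (Polynomial-cost (f false)) (Polynomial-cost (f true))))
Polynomial-cost (p ⨟ q)     = Polynomial-+ (Polynomial-cost p) (Polynomial-+ (Polynomial-cost q) (Polynomial-const 1))
Polynomial-cost (loop p)    = Polynomial-+ (Polynomial-const 1)
  (Polynomial-* Polynomial-id (Polynomial-+ (Polynomial-const 1) (Polynomial-cost p)))

-- A positive `n` satisfies `suc n ≤ 2 * n`; the summand 1 takes care of `n = 0`.
monomial-bound : ∀ n d → suc n ^ d ≤ 2 ^ d * n ^ d + 1
monomial-bound zero    d = ≤-trans (≤-reflexive (^-zeroˡ d)) (m≤n+m 1 (2 ^ d * zero ^ d))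
monomial-bound (suc n) d = begin
  suc (suc n) ^ d         ≤⟨ ^-monoˡ-≤ d (≤-trans (s≤s (m≤n+m (suc n) n)) (≤-reflexive (double n))) ⟩
  (2 * suc n) ^ d         ≡⟨ ^-distribʳ-* d 2 (suc n) ⟩
  2 ^ d * suc n ^ d       ≤⟨ m≤m+n _ 1 ⟩
  2 ^ d * suc n ^ d + 1   ∎
  where
  open ≤-Reasoning
  double : ∀ n → suc (n + suc n) ≡ 2 * suc n
  double = solve-∀

eval-polytime : ∀ {k D} (C : Cmd (suc k) D) → PolyTimeComputable (Program.eval k D C)
eval-polytime {k} {D} C = ToTM.tm (machine C) , c , d , λ w →
  let (T , eq , t , x , r , le) = machine-correct C w
      (halted , out) = ToTM.correct (machine C) w r (≤-trans le (time (length w)))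
  in halted , trans out eq
  where
  open Program k D
  open Compile (suc k) D input
  steps-polynomial : Polynomial (steps C)
  steps-polynomial = Polynomial-+ (Polynomial-const 1)
    (Polynomial-* (Polynomial-+ (Polynomial-cost C) (Polynomial-const 1)) (Polynomial-+ (Polynomial-const 3)
        (Polynomial-+ L L)))
    where L = Polynomial-+ Polynomial-id (Polynomial-cost C)
  a = proj₁ steps-polynomial
  d = proj₁ (proj₂ steps-polynomial)
  c = a * 2 ^ d + a
  time : ∀ n → steps C n ≤ c * n ^ d + c
  time n = begin
    steps C n                       ≤⟨ proj₂ (proj₂ steps-polynomial) n ⟩
    a * suc n ^ d                   ≤⟨ *-monoʳ-≤ a (monomial-bound n d) ⟩
    a * (2 ^ d * n ^ d + 1)         ≡⟨ arith a (2 ^ d) (n ^ d) ⟩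
    a * 2 ^ d * n ^ d + a           ≤⟨ +-mono-≤ (*-monoˡ-≤ (n ^ d) (m≤m+n (a * 2 ^ d) a)) (m≤n+m a (a * 2 ^ d)) ⟩
    c * n ^ d + c                   ∎
    where
    open ≤-Reasoning
    arith : ∀ a x y → a * (x * y + 1) ≡ a * x * y + a
    arith = solve-∀

-- Bounded loops as folds

foldM : ∀ {A : Set} → (Bool → A → Maybe A) → List Bool → A → Maybe A
foldM f []       a = just a
foldM f (b ∷ bs) a = f b a >>= foldM f bs

private
  variable A B C : Set

map->>= : ∀ {f : A → B} {k : B → Maybe C} m → (Maybe.map f m >>= k) ≡ (m >>= k ∘ f)
map->>= nothing  = refl
map->>= (just a) = refl

>>=-map : ∀ {f : B → C} {k : A → Maybe B} m → (m >>= Maybe.map f ∘ k) ≡ Maybe.map f (m >>= k)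
>>=-map nothing  = refl
>>=-map (just a) = refl

>>=-cong : ∀ {k l : A → Maybe B} m → (∀ a → k a ≡ l a) → (m >>= k) ≡ (m >>= l)
>>=-cong nothing  eq = refl
>>=-cong (just a) eq = eq a

>>=-congˡ : ∀ {k : A → Maybe B} {x y r} → x ≡ y → (y >>= k) ≡ r → (x >>= k) ≡ r
>>=-congˡ refl eq = eq

>>=-assoc : ∀ {k : A → Maybe B} {l : B → Maybe C} m → ((m >>= k) >>= l) ≡ (m >>= λ a → k a >>= l)
>>=-assoc nothing  = refl
>>=-assoc (just a) = refl

foldM-cong : ∀ {f g : Bool → A → Maybe A} → (∀ b a → f b a ≡ g b a) → ∀ bs a → foldM f bs a ≡ foldM g bs a
foldM-cong eq []       a = refl
foldM-cong {g = g} eq (b ∷ bs) a rewrite eq b a = >>=-cong (g b a) (foldM-cong eq bs)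

iterate-fixed : ∀ {f : A → Maybe A} {a} → f a ≡ just a → ∀ n → iterate n f a ≡ just a
iterate-fixed eq zero = refl
iterate-fixed eq (suc n) rewrite eq = iterate-fixed eq n

iterate-+ : ∀ {f : A → Maybe A} m n {a} → iterate (m + n) f a ≡ (iterate m f a >>= iterate n f)
iterate-+ zero    n = refl
iterate-+ {f = f} (suc m) n {a} =
  trans (>>=-cong (f a) (λ a → iterate-+ m n)) (Eq.sym (>>=-assoc (f a)))

iterate-* : ∀ {f : A → Maybe A} m n {a} → iterate m (iterate n f) a ≡ iterate (m * n) f a
iterate-* zero    n = refl
iterate-* {f = f} (suc m) n {a} =
  trans (>>=-cong (iterate n f a) (λ a → iterate-* m n)) (Eq.sym (iterate-+ n (m * n)))

foldM-const : ∀ {f : A → Maybe A} bs a → foldM (λ _ → f) bs a ≡ iterate (length bs) f a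
foldM-const     []       a = refl
foldM-const {f = f} (b ∷ bs) a = >>=-cong (f a) (foldM-const bs)

foldM-snoc : ∀ ys zs → foldM (λ y zs → just (zs ++ y ∷ [])) ys zs ≡ just (zs ++ ys)
foldM-snoc []       zs = cong just (Eq.sym (++-identityʳ zs))
foldM-snoc (y ∷ ys) zs = trans (foldM-snoc ys (zs ++ y ∷ [])) (cong just (++-assoc zs (y ∷ []) ys))

-- Each iteration consumes one bit. Once the queue is empty the state is a fixed point, so the exact
-- number of iterations is immaterial as long as it reaches the length of the queue.
iterate-drain : ∀ {S B : Set} {F : S → Maybe S} (h : List Bool → B → S) (f : Bool → B → Maybe B) →
                (∀ b → F (h [] b) ≡ just (h [] b)) → (∀ x xs b → F (h (x ∷ xs) b) ≡ Maybe.map (h xs) (f x b)) →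
                ∀ n xs b → length xs ≤ n → iterate n F (h xs b) ≡ Maybe.map (h []) (foldM f xs b)
iterate-drain h f h-[] h-∷ n       []       b le       = iterate-fixed (h-[] b) n
iterate-drain h f h-[] h-∷ (suc n) (x ∷ xs) b (s≤s le) rewrite h-∷ x xs b =
  trans (map->>= (f x b)) (trans (>>=-cong (f x b) (λ b → iterate-drain h f h-[] h-∷ n xs b le)) (>>=-map (f x b)))

-- g presents the states in which queue q holds the first argument and queue t the second one.
Focus : ∀ {k} → Fin k → Fin k → {A : Set} → (List Bool → List Bool → A → State k) → Set
Focus q t g = ∀ xs ys a xs′ ys′ →
  (lookup (g xs ys a) q , lookup (g xs ys a) t , g xs ys a [ q ]≔ xs′ , g xs ys a [ t ]≔ ys′) ≡
  (xs , ys , g xs′ ys a , g xs ys′ a)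

module _ {k : ℕ} where

  drain : ∀ {c} → Fin k → (Bool → Cmd k c) → Cmd k (suc c)
  drain q body = loop (deq q skip body)

  -- t is a scratch queue through which q is restored.
  each : ∀ {c} → Fin k → Fin k → (Bool → Cmd k c) → Cmd k (suc c)
  each q t body = drain q (λ b → enq t b ⨟ body b) ⨟ drain t (enq q)

  module _ (N : ℕ) where

    -- The hypothesis on the body holds for all contents of `q` and `t` and returns them unchanged,
    -- which expresses that the body leaves both queues alone.
    each-correct : ∀ {c q t} {A : Set} {g : List Bool → List Bool → A → State k} → Focus q t g →
      {body : Bool → Cmd k c} {f : Bool → A → Maybe A} →
      (∀ xs ys b a → ⟦_⟧ N (body b) (g xs ys a) ≡ Maybe.map (g xs ys) (f b a)) →
      ∀ xs a → length xs ≤ N → ⟦_⟧ N (each q t body) (g xs [] a) ≡ Maybe.map (g xs []) (foldM f xs a)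
    each-correct {c} {q} {t} {A} {g} F {body} {f} body-f xs a le = begin
      (iterate N (⟦_⟧ N (deq q skip (λ b → enq t b ⨟ body b))) (g xs [] a) >>= restore)
        ≡⟨ cong (_>>= restore) (iterate-drain (λ xs (ys , a) → g xs ys a) transfer (λ _ → transfer-[] _ _)
            (λ _ _ _ → transfer-∷ _ _ _ _) N xs ([] , a) le) ⟩
      (Maybe.map (λ (ys , a) → g [] ys a) (foldM transfer xs ([] , a)) >>= restore)
        ≡⟨ cong (λ m → Maybe.map (λ (ys , a) → g [] ys a) m >>= restore) (foldM-transfer xs [] a) ⟩
      (Maybe.map (λ (ys , a) → g [] ys a) (Maybe.map (xs ,_) (foldM f xs a)) >>= restore)
        ≡⟨ restored (foldM f xs a) ⟩
      Maybe.map (g xs []) (foldM f xs a) ∎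
      where
      open Eq.≡-Reasoning

      lookup-q : ∀ xs ys a → lookup (g xs ys a) q ≡ xs
      lookup-q xs ys a = cong proj₁ (F xs ys a xs ys)
      lookup-t : ∀ xs ys a → lookup (g xs ys a) t ≡ ys
      lookup-t xs ys a = cong (proj₁ ∘ proj₂) (F xs ys a xs ys)
      update-q : ∀ xs ys a xs′ → g xs ys a [ q ]≔ xs′ ≡ g xs′ ys a
      update-q xs ys a xs′ = cong (proj₁ ∘ proj₂ ∘ proj₂) (F xs ys a xs′ ys)
      update-t : ∀ xs ys a ys′ → g xs ys a [ t ]≔ ys′ ≡ g xs ys′ a
      update-t xs ys a ys′ = cong (proj₂ ∘ proj₂ ∘ proj₂) (F xs ys a xs ys′)

      restore : State k → Maybe (State k)
      restore = iterate N (⟦_⟧ N (deq {c = c} t skip (enq q)))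

      transfer : Bool → List Bool × A → Maybe (List Bool × A)
      transfer b (ys , a) = Maybe.map (ys ++ b ∷ [] ,_) (f b a)

      transfer-[] : ∀ ys a → ⟦_⟧ N (deq q skip (λ b → enq t b ⨟ body b)) (g [] ys a) ≡ just (g [] ys a)
      transfer-[] ys a rewrite lookup-q [] ys a = refl

      transfer-∷ : ∀ x xs ys a → ⟦_⟧ N (deq q skip (λ b → enq t b ⨟ body b)) (g (x ∷ xs) ys a) ≡
                Maybe.map (λ (ys , a) → g xs ys a) (transfer x (ys , a))
      transfer-∷ x xs ys a rewrite lookup-q (x ∷ xs) ys a | update-q (x ∷ xs) ys a xs | lookup-t xs ys a
        | update-t xs ys a (ys ++ x ∷ []) | body-f xs (ys ++ x ∷ []) x a with f x a
      ... | nothing = refl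
      ... | just _  = refl

      foldM-transfer : ∀ xs ys a → foldM transfer xs (ys , a) ≡ Maybe.map (ys ++ xs ,_) (foldM f xs a)
      foldM-transfer []       ys a = cong (λ ys → just (ys , a)) (Eq.sym (++-identityʳ ys))
      foldM-transfer (x ∷ xs) ys a with f x a
      ... | nothing = refl
      ... | just a′ = trans (foldM-transfer xs (ys ++ x ∷ []) a′)
        (cong (λ ys → Maybe.map (ys ,_) (foldM f xs a′)) (++-assoc ys (x ∷ []) xs))

      back-[] : ∀ zs a → ⟦_⟧ N (deq {c = c} t skip (enq q)) (g zs [] a) ≡ just (g zs [] a)
      back-[] zs a rewrite lookup-t zs [] a = refl

      back-∷ : ∀ y ys zs a → ⟦_⟧ N (deq {c = c} t skip (enq q)) (g zs (y ∷ ys) a) ≡ just (g (zs ++ y ∷ []) ys a)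
      back-∷ y ys zs a rewrite lookup-t zs (y ∷ ys) a | update-t zs (y ∷ ys) a ys | lookup-q zs ys a
        | update-q zs ys a (zs ++ y ∷ []) = refl

      restored : ∀ m → (Maybe.map (λ (ys , a) → g [] ys a) (Maybe.map (xs ,_) m) >>= restore) ≡ Maybe.map (g xs []) m
      restored nothing  = refl
      restored (just a) = trans
        (iterate-drain (λ ys zs → g zs ys a) (λ y zs → just (zs ++ y ∷ [])) (λ zs → back-[] zs a)
            (λ y ys zs → back-∷ y ys zs a) N xs [] le)
        (cong (Maybe.map (λ zs → g zs [] a)) (foldM-snoc xs []))

-- The reduction as a queue program

-- The input is 1ⁿ 0 A 1ⁿ 0 B with n × n matrices A and B. Queue io holds the rest of the input and later the
-- output, u and v hold 1ⁿ, and m is the matrix under elimination, of size given in unary by w.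
module Queues where
  io u u′ v v′ a b m r r′ c c′ z w : Fin 14
  io = # 0
  u  = # 1
  u′ = # 2
  v  = # 3
  v′ = # 4
  a  = # 5
  b  = # 6
  m  = # 7
  r  = # 8
  r′ = # 9
  c  = # 10
  c′ = # 11
  z  = # 12
  w  = # 13

private
  module Q = Queues

  variable d : ℕ

copy : Fin 14 → Fin 14 → Fin 14 → Cmd 14 (suc d)
copy q t q′ = each q t (enq q′)

expect : Bool → Cmd 14 d
expect x = deq Q.io abort (λ y → if x xor y then abort else skip)

-- The loop goes on after the separating zero, so a bit in `z` records that the zero has been met;
-- later iterations merely put this bit back. If it is missing at the end, the input contained no
-- zero.
readOnes : Cmd 14 (suc d)
readOnes = loop (deq Q.z (deq Q.io skip (λ x → if x then enq Q.u true else enq Q.z true)) (enq Q.z))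
         ⨟ deq Q.z abort (λ _ → skip)

readMatrix : Fin 14 → Cmd 14 (suc (suc d))
readMatrix q = each Q.u Q.u′ (λ _ → each Q.v Q.v′ (λ _ → deq Q.io abort (enq q)))

-- The first bit is treated separately because a connected graph has a node. The second size is
-- checked against the first one: graphs of different orders are not isomorphic and may be rejected
-- at once.
parse : Cmd 14 (suc (suc d))
parse = expect true ⨟ enq Q.u true ⨟ readOnes ⨟ copy Q.u Q.u′ Q.v
      ⨟ readMatrix Q.a
      ⨟ each Q.u Q.u′ (λ _ → expect true) ⨟ expect false
      ⨟ readMatrix Q.b
      ⨟ deq Q.io skip (λ _ → abort)

-- `z` serves as a flag for a neighbour found. Without one, only an empty `w` is acceptable, meaning
-- that no other node is left.
requireNeighbour : Cmd 14 (suc d)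
requireNeighbour = each Q.r Q.r′ (λ x → if x then deq Q.z (enq Q.z true) (λ _ → enq Q.z true) else skip)
                 ⨟ deq Q.z (deq Q.w skip (λ _ → abort)) (λ _ → skip)

-- Checks that the first row and the first column agree and deletes both; when o holds, the neighbours of
-- the deleted node (there must be one unless it is the last node) become a clique.
eliminate : Bool → Cmd 14 (suc (suc d))
eliminate o = deq Q.w skip λ _ →
    -- The diagonal entry is dropped: a loop is irrelevant to symmetry and to connectivity.
    deq Q.m abort (λ _ → skip)
  ⨟ each Q.w Q.v′ (λ _ → deq Q.m abort (λ x → enq Q.r x ⨟ enq Q.c x))
  ⨟ (if o then requireNeighbour else skip)
  ⨟ each Q.r Q.r′ (λ x → deq Q.m abort (λ y → if x xor y then abort else
      each Q.c Q.c′ (λ t → deq Q.m abort (λ s → enq Q.m (s ∨ (o ∧ (y ∧ t)))))))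
  ⨟ drain Q.r (λ _ → skip) ⨟ drain Q.c (λ _ → skip)

eliminateAll : Fin 14 → Bool → Cmd 14 (suc (suc (suc d)))
eliminateAll q o = copy q Q.r′ Q.m ⨟ copy Q.u Q.u′ Q.w ⨟ loop (eliminate o)

-- Two passes are made because the clique edges added in the second one could mask a pair of unequal
-- entries; symmetry is therefore tested on the unaltered matrix.
check : Fin 14 → Cmd 14 (suc (suc (suc d)))
check q = eliminateAll q false ⨟ eliminateAll q true

emits : List Bool → Cmd 14 d
emits []       = skip
emits (x ∷ xs) = enq Q.io x ⨟ emits xs

fill : Bool → Cmd 14 (suc d)
fill x = each Q.v Q.v′ (λ _ → enq Q.io x)

emitRow : Bool → List Bool → Cmd 14 (suc d) → Cmd 14 (suc d)
emitRow onLeft xs p = if onLeft then entries ⨟ zeros else zeros ⨟ entries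
  where
  zeros entries : Cmd 14 _
  zeros   = emits (false ∷ false ∷ []) ⨟ fill false
  entries = emits xs ⨟ p

-- The rows of `doubleCone`: that of `p`, that of the loopless `u`, and those of the matrix, each
-- preceded by the adjacencies to `p` and `u`.
emitBlock : Bool → Cmd 14 (suc (suc d))
emitBlock onLeft = emitRow onLeft (true ∷ true ∷ []) (fill true)
               ⨟ emitRow onLeft (true ∷ false ∷ []) (fill true)
               ⨟ each Q.u Q.u′ (λ _ → emitRow onLeft (true ∷ true ∷ []) (each Q.v Q.v′ (λ _ → deq Q.m abort (enq Q.io))))

emit : Cmd 14 (suc (suc d))
-- The size in unary: four added nodes, and two nodes for each unit of the common order.
emit = emits (true ∷ true ∷ true ∷ true ∷ []) ⨟ each Q.u Q.u′ (λ _ → emits (true ∷ true ∷ [])) ⨟ emits (false ∷ [])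
     ⨟ copy Q.a Q.r′ Q.m ⨟ emitBlock true ⨟ copy Q.b Q.r′ Q.m ⨟ emitBlock false

reduction : Cmd 14 3
reduction = parse ⨟ check Q.a ⨟ check Q.b ⨟ emit

state : (io u u′ v v′ a b m r r′ c c′ z w : List Bool) → State 14
state io u u′ v v′ a b m r r′ c c′ z w =
  io ∷ u ∷ u′ ∷ v ∷ v′ ∷ a ∷ b ∷ m ∷ r ∷ r′ ∷ c ∷ c′ ∷ z ∷ w ∷ []

ones : ℕ → List Bool
ones n = replicate n true

-- Correctness of the parser

scan : List Bool → Maybe (ℕ × List Bool)
scan []           = nothing
scan (false ∷ xs) = just (0 , xs)
scan (true ∷ xs)  = Maybe.map (λ (n , ys) → suc n , ys) (scan xs)

expected : Bool → List Bool → Maybe (List Bool)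
expected x []       = nothing
expected x (y ∷ ys) = if x xor y then nothing else just ys

pull : List Bool × List Bool → Maybe (List Bool × List Bool)
pull ([]     , ys) = nothing
pull (x ∷ xs , ys) = just (xs , ys ++ x ∷ [])

module Execution (N : ℕ) where

  exec : ∀ {d} → Cmd 14 d → State 14 → Maybe (State 14)
  exec = ⟦_⟧ N

  -- Matches a command with a pure function one bind at a time. The continuation may use
  -- `x ≡ just a`, which is how length bounds reach the later stages of the parser.
  seq : ∀ {A B S T : Set} {f : A → S} {h : B → T} {k : A → Maybe B} {m K} x → m ≡ Maybe.map f x →
        (∀ a → x ≡ just a → K (f a) ≡ Maybe.map h (k a)) → (m >>= K) ≡ Maybe.map h (x >>= k)
  seq nothing  refl q = refl
  seq (just a) refl q = q a refl

  reading : List Bool → List Bool → List Bool → List Bool → List Bool → List Bool → List Bool → State 14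
  reading io u u′ v v′ a b = state io u u′ v v′ a b [] [] [] [] [] [] []

  expect-correct : ∀ {d} x io {u u′ v v′ a b} → exec (expect {d} x) (reading io u u′ v v′ a b) ≡
                   Maybe.map (λ io → reading io u u′ v v′ a b) (expected x io)
  expect-correct x []       = refl
  expect-correct x (y ∷ io) with x xor y
  ... | true  = refl
  ... | false = refl

  readOnes-correct : ∀ {d} io us → length io ≤ N →
    exec (readOnes {d}) (reading io us [] [] [] [] []) ≡
    Maybe.map (λ (n , io) → reading io (us ++ ones n) [] [] [] [] []) (scan io)
  readOnes-correct {d} io us le = trans (cong (_>>= exec (deq (# 12) abort (λ _ → skip))) (go N io us le)) (finish
      (scan io))
    where
    scanning : List Bool → List Bool → List Bool → State 14
    scanning io u z = state io u [] [] [] [] [] [] [] [] [] [] z []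

    body : Cmd 14 d
    body = deq (# 12) (deq (# 0) skip (λ x → if x then enq (# 1) true else enq (# 12) true)) (enq (# 12))

    scanned : List Bool → List Bool → Maybe (ℕ × List Bool) → State 14
    scanned io us nothing        = scanning [] (us ++ io) []
    scanned io us (just (n , y)) = scanning y (us ++ ones n) (true ∷ [])

    scanned-∷ : ∀ io us x → scanned io (us ++ true ∷ []) x ≡ scanned (true ∷ io) us (Maybe.map (λ
        (n , ys) → suc n , ys) x)
    scanned-∷ io us nothing        = cong (λ u → scanning [] u []) (++-assoc us (true ∷ []) io)
    scanned-∷ io us (just (n , y)) = cong (λ u → scanning y u (true ∷ [])) (++-assoc us (true ∷ []) (ones n))

    go : ∀ k io us → length io ≤ k → iterate k (exec body) (scanning io us []) ≡ just (scanned io us (scan io))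
    go k []                us le       = trans (iterate-fixed refl k) (cong (λ u → just (scanning [] u []))
        (Eq.sym (++-identityʳ us)))
    go (suc k) (false ∷ io) us (s≤s le) = trans (iterate-fixed refl k) (cong (λ u → just (scanning io u
        (true ∷ []))) (Eq.sym (++-identityʳ us)))
    go (suc k) (true ∷ io) us (s≤s le) = trans (go k io (us ++ true ∷ []) le) (cong just (scanned-∷ io us (scan io)))

    finish : ∀ x → exec {suc d} (deq (# 12) abort (λ _ → skip)) (scanned io us x) ≡
             Maybe.map (λ (n , io) → reading io (us ++ ones n) [] [] [] [] []) x
    finish nothing  = refl
    finish (just _) = refl

  readMatrix-correct : ∀ {d} io n a → n ≤ N →
    (∀ {b} → exec (readMatrix {d} Queues.a) (reading io (ones n) [] (ones n) [] a b) ≡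
       Maybe.map (λ (io , a) → reading io (ones n) [] (ones n) [] a b) (iterate (n * n) pull (io , a))) ×
    (∀ {b} → exec (readMatrix {d} Queues.b) (reading io (ones n) [] (ones n) [] b a) ≡
       Maybe.map (λ (io , a) → reading io (ones n) [] (ones n) [] b a) (iterate (n * n) pull (io , a)))
  readMatrix-correct io n a n≤N =
    (λ {b} → trans
      (each-correct N {g = λ u u′ (io , a) → reading io u u′ (ones n) [] a b} (λ _ _ _ _ _ → refl)
        (λ u u′ _ ia → each-correct N {g = λ v v′ (io , a) → reading io u u′ v v′ a b} (λ _ _ _ _ _ → refl)
          (λ { _ _ _ ([] , _) → refl ; _ _ _ (_ ∷ _ , _) → refl }) (ones n) ia |ones|≤N)
        (ones n) (io , a) |ones|≤N)
      (cong (Maybe.map _) nested)) ,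
    (λ {b} → trans
      (each-correct N {g = λ u u′ (io , a) → reading io u u′ (ones n) [] b a} (λ _ _ _ _ _ → refl)
        (λ u u′ _ ia → each-correct N {g = λ v v′ (io , a) → reading io u u′ v v′ b a} (λ _ _ _ _ _ → refl)
          (λ { _ _ _ ([] , _) → refl ; _ _ _ (_ ∷ _ , _) → refl }) (ones n) ia |ones|≤N)
        (ones n) (io , a) |ones|≤N)
      (cong (Maybe.map _) nested))
    where
    |ones|≤N : length (ones n) ≤ N
    |ones|≤N = ≤-trans (≤-reflexive (length-replicate n)) n≤N
    nested : foldM (λ _ → foldM (λ _ → pull) (ones n)) (ones n) (io , a) ≡ iterate (n * n) pull (io , a)
    nested = trans (foldM-cong (λ _ ia → trans (foldM-const (ones n) ia) (cong (λ k → iterate k pull ia)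
        (length-replicate n))) (ones n) (io , a))
      (trans (foldM-const (ones n) (io , a)) (trans (cong (λ k → iterate k (iterate n pull) (io , a))
          (length-replicate n)) (iterate-* n n)))

  ended : List Bool → Maybe (List Bool)
  ended []      = just []
  ended (_ ∷ _) = nothing

  parsed : List Bool → Maybe (ℕ × List Bool × List Bool)
  parsed x =
    expected true x >>= λ x → scan x >>= λ (m , x) → let n = suc m in
    iterate (n * n) pull (x , []) >>= λ (x , a) →
    iterate n (expected true) x >>= λ x → expected false x >>= λ x →
    iterate (n * n) pull (x , []) >>= λ (x , b) → ended x >>= λ _ → just (n , a , b)

  ready : ℕ → List Bool → List Bool → State 14
  ready n a b = reading [] (ones n) [] (ones n) [] a b

  private
    expected-length : ∀ x y {z} → expected x y ≡ just z → suc (length z) ≡ length y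
    expected-length x (y ∷ ys) eq with x xor y
    expected-length x (y ∷ ys) refl | false = refl

    scan-length : ∀ x {n y} → scan x ≡ just (n , y) → suc n ≤ length x
    scan-length (false ∷ x) refl = s≤s z≤n
    scan-length (true ∷ x)  eq with scan x in eq′
    scan-length (true ∷ x)  refl | just _ = s≤s (scan-length x eq′)

  parse-correct : ∀ {d} x → length x ≤ N → exec (parse {d}) (reading x [] [] [] [] [] []) ≡
                  Maybe.map (λ (n , a , b) → ready n a b) (parsed x)
  parse-correct {d} x le =
    seq (expected true x) (expect-correct true x) λ x₁ eq₁ →
    let le₁ = ≤-trans (n≤1+n _) (≤-trans (≤-reflexive (expected-length true x eq₁)) le) in
    seq (scan x₁) (readOnes-correct x₁ (true ∷ []) le₁) λ (m , x₂) eq₂ →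
    let n = suc m
        n≤N : n ≤ N
        n≤N = ≤-trans (scan-length x₁ eq₂) le₁
        |ones|≤N : length (ones n) ≤ N
        |ones|≤N = ≤-trans (≤-reflexive (length-replicate n)) n≤N
    in
    trans (cong (_>>= _) (copied n x₂ |ones|≤N)) (
    seq (iterate (n * n) pull (x₂ , [])) (proj₁ (readMatrix-correct x₂ n [] n≤N)) λ (x₃ , a) _ →
    seq (iterate n (expected true) x₃) (expectOnes n x₃ a |ones|≤N) λ x₄ _ →
    seq (expected false x₄) (expect-correct false x₄) λ x₅ _ →
    seq (iterate (n * n) pull (x₅ , [])) (proj₂ (readMatrix-correct x₅ n [] n≤N)) λ { ([] , b) _ → refl ;
        (_ ∷ _ , b) _ → refl })
    where
    copied : ∀ {d} n x → length (ones n) ≤ N → exec (copy {d} (# 1) (# 2) (# 3)) (reading x (ones n) [] [] [] [] []) ≡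
             just (reading x (ones n) [] (ones n) [] [] [])
    copied n x le = trans (each-correct N {g = λ u u′ v → reading x u u′ v [] [] []} (λ _ _ _ _ _ → refl)
      {f = λ b v → just (v ++ b ∷ [])} (λ _ _ _ _ → refl) (ones n) [] le) (cong (Maybe.map _) (foldM-snoc (ones n) []))

    expectOnes : ∀ {d} n x a → length (ones n) ≤ N →
      exec (each {c = d} (# 1) (# 2) (λ _ → expect true)) (reading x (ones n) [] (ones n) [] a []) ≡
      Maybe.map (λ x → reading x (ones n) [] (ones n) [] a []) (iterate n (expected true) x)
    expectOnes {d} n x a le = trans
      (each-correct N {c = d} {g = λ u u′ x → reading x u u′ (ones n) [] a []}
          (λ _ _ _ _ _ → refl) {f = λ _ → expected true}
        (λ _ _ _ x → expect-correct true x) (ones n) x le)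
      (cong (Maybe.map _) (trans (foldM-const (ones n) x) (cong (λ k → iterate k (expected true) x)
          (length-replicate n))))

private
  scan-sound : ∀ x {m y} → scan x ≡ just (m , y) → x ≡ ones m ++ false ∷ y
  scan-sound (false ∷ x) refl = refl
  scan-sound (true ∷ x)  eq with scan x in eq′
  scan-sound (true ∷ x)  refl | just _ = cong (true ∷_) (scan-sound x eq′)

  scan-complete : ∀ m y → scan (ones m ++ false ∷ y) ≡ just (m , y)
  scan-complete zero    y = refl
  scan-complete (suc m) y rewrite scan-complete m y = refl

  pull-sound : ∀ k x a {y a′} → iterate k pull (x , a) ≡ just (y , a′) →
               ∃ λ bs → length bs ≡ k × x ≡ bs ++ y × a′ ≡ a ++ bs
  pull-sound zero    x       a refl = [] , refl , refl , Eq.sym (++-identityʳ a)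
  pull-sound (suc k) (b ∷ x) a eq with pull-sound k x (a ++ b ∷ []) eq
  ... | bs , len , refl , refl = b ∷ bs , cong suc len , refl , ++-assoc a (b ∷ []) bs

  pull-complete : ∀ bs y a → iterate (length bs) pull (bs ++ y , a) ≡ just (y , a ++ bs)
  pull-complete []       y a = cong (λ a → just (y , a)) (Eq.sym (++-identityʳ a))
  pull-complete (b ∷ bs) y a = trans (pull-complete bs y (a ++ b ∷ []))
    (cong (λ a → just (y , a)) (++-assoc a (b ∷ []) bs))

  expected-sound : ∀ b x {y} → expected b x ≡ just y → x ≡ b ∷ y
  expected-sound false (false ∷ x) refl = refl
  expected-sound true  (true ∷ x)  refl = refl

  ones-sound : ∀ n x {y} → iterate n (expected true) x ≡ just y → x ≡ ones n ++ y
  ones-sound zero    x          refl = refl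
  ones-sound (suc n) (true ∷ x) eq   = cong (true ∷_) (ones-sound n x eq)

  ones-complete : ∀ n y → iterate n (expected true) (ones n ++ y) ≡ just y
  ones-complete zero    y = refl
  ones-complete (suc n) y = ones-complete n y

-- The concatenated encodings of two matrices of order n, bracketed in the order in which they are read.
encoded : ℕ → List Bool → List Bool → List Bool
encoded n a b = ones n ++ false ∷ (a ++ (ones n ++ false ∷ b))

module _ (N : ℕ) where
  open Execution N using (parsed; ended)

  parsed-sound : ∀ x {n a b} → parsed x ≡ just (n , a , b) →
                 1 ≤ n × length a ≡ n * n × length b ≡ n * n × x ≡ encoded n a b
  parsed-sound x eq with expected true x in eq₁
  ... | just x₁ with scan x₁ in eq₂
  ... | just (m , x₂) with iterate (suc m * suc m) pull (x₂ , []) in eq₃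
  ... | just (x₃ , a) with iterate (suc m) (expected true) x₃ in eq₄
  ... | just x₄ with expected false x₄ in eq₅
  ... | just x₅ with iterate (suc m * suc m) pull (x₅ , []) in eq₆
  parsed-sound x refl | just x₁ | just (m , x₂) | just (x₃ , a) | just x₄ | just x₅ | just ([] , b)
    with pull-sound (suc m * suc m) x₂ [] eq₃ | pull-sound (suc m * suc m) x₅ [] eq₆
  ... | _ , |a| , refl , refl | _ , |b| , refl , refl
    rewrite expected-sound true x eq₁ | scan-sound x₁ eq₂ | ones-sound (suc m) x₃ eq₄ | expected-sound false x₄ eq₅
    | ++-identityʳ b = s≤s z≤n , |a| , |b| , refl

  parsed-complete : ∀ m a b → length a ≡ suc m * suc m → length b ≡ suc m * suc m →
                    parsed (encoded (suc m) a b) ≡ just (suc m , a , b)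
  parsed-complete m a b |a| |b| =
    bind (scan-complete m (a ++ (ones (suc m) ++ false ∷ b))) (
    bind (pulls a |a| (ones (suc m) ++ false ∷ b)) (
    bind (ones-complete (suc m) (false ∷ b)) (
    bind (subst (λ x → iterate (suc m * suc m) pull (x , []) ≡ just ([] , b)) (++-identityʳ b) (pulls b |b| [])) refl)))
    where
    bind : ∀ {A B : Set} {x : Maybe A} {k : A → Maybe B} {a r} → x ≡ just a → k a ≡ r → (x >>= k) ≡ r
    bind refl eq = eq
    pulls : ∀ {k} bs → length bs ≡ k → ∀ y → iterate k pull (bs ++ y , []) ≡ just (y , bs)
    pulls bs refl y = pull-complete bs y []

-- Correctness of the elimination

rows : ∀ {m} → (Fin m → List Bool) → List Bool
rows f = concat (tabulate f)

Matrix : ℕ → Set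
Matrix n = Fin n → Fin n → Bool

flat : ∀ n → Matrix n → List Bool
flat n a = rows (λ i → tabulate (a i))

assert : ∀ {A : Set} → Bool → A → Maybe A
assert b a = if b then just a else nothing

agree : ∀ {p} → (Fin p → Bool) → (Fin p → Bool) → Bool
agree {zero}  x y = true
agree {suc p} x y = not (x zero xor y zero) ∧ agree (x ∘ suc) (y ∘ suc)

some : ∀ {p} → (Fin p → Bool) → Bool
some {zero}  x = false
some {suc p} x = x zero ∨ some (x ∘ suc)

eliminated : Bool → ∀ {p} → Matrix (suc p) → Matrix p
eliminated o a i j = a (suc i) (suc j) ∨ (o ∧ (a (suc i) zero ∧ a zero (suc j)))

-- For `o = false` this tests symmetry, and for `o = true` connectivity of a symmetric matrix. The
-- disjunct `p ≡ᵇ 0` exempts the last node from having a neighbour.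
accepts : Bool → ∀ n → Matrix n → Bool
accepts o zero    a = true
accepts o (suc p) a = (if o then some (a zero ∘ suc) ∨ (p ≡ᵇ 0) else true) ∧
  (agree (a zero ∘ suc) (λ i → a (suc i) zero) ∧ accepts o p (eliminated o a))

module Elimination (N : ℕ) (io u v a b : List Bool) where
  open Execution N using (exec; seq)

  working : List Bool → List Bool → List Bool → List Bool → List Bool → State 14
  working m r c z w = state io u [] v [] a b m r [] c [] z w

  duplicate : List Bool × List Bool × List Bool → Maybe (List Bool × List Bool × List Bool)
  duplicate ([]    , r , c) = nothing
  duplicate (x ∷ m , r , c) = just (m , r ++ x ∷ [] , c ++ x ∷ [])

  iterate-duplicate : ∀ {p} (x : Fin p → Bool) m r c → iterate p duplicate (tabulate x ++ m , r , c) ≡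
                      just (m , r ++ tabulate x , c ++ tabulate x)
  iterate-duplicate {zero}  x m r c = cong₂ (λ r c → just (m , r , c)) (Eq.sym (++-identityʳ r)) (Eq.sym (++-identityʳ c))
  iterate-duplicate {suc p} x m r c = trans (iterate-duplicate (x ∘ suc) m (r ++ x zero ∷ []) (c ++ x zero ∷ []))
    (cong₂ (λ r c → just (m , r , c)) (++-assoc r _ _) (++-assoc c _ _))

  duplicate-correct : ∀ {d p} (x : Fin p → Bool) m → p ≤ N →
    exec (each {c = d} Queues.w Queues.v′ (λ _ → deq Queues.m abort (λ x → enq Queues.r x ⨟ enq Queues.c x)))
      (working (tabulate x ++ m) [] [] [] (ones p)) ≡ just (working m (tabulate x) (tabulate x) [] (ones p))
  duplicate-correct {d} {p} x m le = trans
    (each-correct N {g = λ w v′ (m , r , c) → state io u [] v v′ a b m r [] c [] [] w} (λ _ _ _ _ _ → refl)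
      {f = λ _ → duplicate} (λ { _ _ _ ([] , _) → refl ; _ _ _ (_ ∷ _ , _) → refl }) (ones p) (tabulate x ++ m , [] , [])
      (≤-trans (≤-reflexive (length-replicate p)) le))
    (cong (Maybe.map _) (trans (foldM-const (ones p) _)
      (trans (cong (λ k → iterate k duplicate (tabulate x ++ m , [] , [])) (length-replicate p))
          (iterate-duplicate x m [] []))))

  flag : Bool → List Bool
  flag false = []
  flag true  = true ∷ []

  raise : Bool → List Bool → List Bool
  raise false z       = z
  raise true  []      = true ∷ []
  raise true  (_ ∷ z) = z ++ true ∷ []

  foldM-raise : ∀ {p} (x : Fin p → Bool) s → foldM (λ b z → just (raise b z)) (tabulate x) (flag s) ≡ just (flag
      (s ∨ some x))
  foldM-raise {zero}  x false = refl
  foldM-raise {zero}  x true  = refl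
  foldM-raise {suc p} x s with x zero | s
  ... | false | s     = foldM-raise (x ∘ suc) s
  ... | true  | false = foldM-raise (x ∘ suc) true
  ... | true  | true  = foldM-raise (x ∘ suc) true

  requireNeighbour-correct : ∀ {d p} (x : Fin p → Bool) m c → p ≤ N →
    exec (requireNeighbour {d}) (working m (tabulate x) c [] (ones p)) ≡
    assert (some x ∨ (p ≡ᵇ 0)) (working m (tabulate x) c [] (ones p))
  requireNeighbour-correct {d} {p} x m c le = trans
    (cong (_>>= exec (deq {c = suc d} Queues.z (deq Queues.w skip (λ _ → abort)) (λ _ → skip))) (trans
      (each-correct N {c = d} {g = λ r r′ z → state io u [] v [] a b m r r′ c [] z (ones p)} (λ _ _ _ _ _ → refl)
        {f = λ b z → just (raise b z)} (λ { _ _ false _ → refl ; _ _ true [] → refl ; _ _ true (_ ∷ _) → refl })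
        (tabulate x) [] (≤-trans (≤-reflexive (length-tabulate x)) le))
      (cong (Maybe.map _) (foldM-raise x false))))
    (decide p (some x))
    where
    decide : ∀ p s → exec (deq {c = suc d} Queues.z (deq Queues.w skip (λ _ → abort)) (λ _ → skip))
      (working m (tabulate x) c (flag s) (ones p)) ≡ assert (s ∨ (p ≡ᵇ 0)) (working m (tabulate x) c [] (ones p))
    decide zero    false = refl
    decide (suc p) false = refl
    decide p       true  = refl

  module _ (o : Bool) where

    joined : Bool → Bool → List Bool → Maybe (List Bool)
    joined y t []      = nothing
    joined y t (s ∷ m) = just (m ++ (s ∨ (o ∧ (y ∧ t))) ∷ [])

    row : List Bool → Bool → List Bool → Maybe (List Bool)
    row c x []      = nothing
    row c x (y ∷ m) = if x xor y then nothing else foldM (joined y) c m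

    foldM-joined : ∀ {p} y (t s : Fin p → Bool) m → foldM (joined y) (tabulate t) (tabulate s ++ m) ≡
                   just (m ++ tabulate (λ j → s j ∨ (o ∧ (y ∧ t j))))
    foldM-joined {zero}  y t s m = cong just (Eq.sym (++-identityʳ m))
    foldM-joined {suc p} y t s m
      rewrite ++-assoc (tabulate (s ∘ suc)) m ((s zero ∨ (o ∧ (y ∧ t zero))) ∷ []) =
      trans (foldM-joined y (t ∘ suc) (s ∘ suc) (m ++ _ ∷ [])) (cong just (++-assoc m _ _))

    -- Unread rows stand at the front of the queue while finished ones collect behind them; this is
    -- why the statement carries an arbitrary tail `m`.
    foldM-row : ∀ {p q} (t : Fin p → Bool) (x h : Fin q → Bool) (s : Fin q → Fin p → Bool) m →
      foldM (row (tabulate t)) (tabulate x) (rows (λ i → h i ∷ tabulate (s i)) ++ m) ≡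
      assert (agree x h) (m ++ rows (λ i → tabulate (λ j → s i j ∨ (o ∧ (h i ∧ t j)))))
    foldM-row {q = zero}  t x h s m = cong just (Eq.sym (++-identityʳ m))
    foldM-row {q = suc q} t x h s m with x zero xor h zero
    ... | true  = refl
    ... | false
      rewrite ++-assoc (tabulate (s zero)) (rows (λ i → h (suc i) ∷ tabulate (s (suc i)))) m
      | foldM-joined (h zero) t (s zero) (rows (λ i → h (suc i) ∷ tabulate (s (suc i))) ++ m)
      | ++-assoc (rows (λ i → h (suc i) ∷ tabulate (s (suc i)))) m (tabulate (λ j → s zero j ∨ (o ∧ (h zero ∧ t j)))) =
      trans (foldM-row t (x ∘ suc) (h ∘ suc) (s ∘ suc) (m ++ _))
        (cong (assert (agree (x ∘ suc) (h ∘ suc))) (++-assoc m _ _))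

    rows-correct : ∀ {d} m r c w → length r ≤ N → length c ≤ N →
      exec (each {c = suc d} Queues.r Queues.r′ (λ x → deq Queues.m abort (λ y → if x xor y then abort else
        each Queues.c Queues.c′ (λ t → deq Queues.m abort (λ s → enq Queues.m (s ∨ (o ∧ (y ∧ t))))))))
        (working m r c [] w) ≡ Maybe.map (λ m → working m r c [] w) (foldM (row c) r m)
    rows-correct {d} m r c w r≤N c≤N =
      each-correct N {g = λ r r′ m → state io u [] v [] a b m r r′ c [] [] w}
          (λ _ _ _ _ _ → refl) {f = row c} body r m r≤N
      where
      body : ∀ r r′ x m → exec (deq {c = suc d} Queues.m abort (λ y → if x xor y then abort else
        each Queues.c Queues.c′ (λ t → deq Queues.m abort (λ s → enq Queues.m (s ∨ (o ∧ (y ∧ t)))))))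
        (state io u [] v [] a b m r r′ c [] [] w) ≡ Maybe.map (λ m → state io u [] v [] a b m r r′ c [] [] w) (row c x m)
      body r r′ x []      = refl
      body r r′ x (y ∷ m) with x xor y
      ... | true  = refl
      ... | false = each-correct N {g = λ c c′ m → state io u [] v [] a b m r r′ c c′ [] w}
          (λ _ _ _ _ _ → refl) {f = joined y}
        (λ { _ _ _ [] → refl ; _ _ _ (_ ∷ _) → refl }) c m c≤N

    clear-correct : ∀ {d} m r c w → length r ≤ N → length c ≤ N →
      exec (drain {c = d} Queues.r (λ _ → skip) ⨟ drain Queues.c (λ _ → skip)) (working m r c [] w) ≡ just
          (working m [] [] [] w)
    clear-correct {d} m r c w r≤N c≤N = trans
      (cong (_>>= exec (drain {c = d} Queues.c (λ _ → skip)))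
        (trans (iterate-drain (λ r c → working m r c [] w) (λ _ → just) (λ _ → refl) (λ _ _ _ → refl) N r c r≤N)
          (cong (Maybe.map _) (foldM-just r c))))
      (trans (iterate-drain (λ c r → working m r c [] w) (λ _ → just) (λ _ → refl) (λ _ _ _ → refl) N c [] c≤N)
        (cong (Maybe.map _) (foldM-just c [])))
      where
      foldM-just : ∀ bs a → foldM {List Bool} (λ _ → just) bs a ≡ just a
      foldM-just []       a = refl
      foldM-just (b ∷ bs) a = foldM-just bs a

  eliminate-correct : ∀ {d} o {p} (s : Matrix (suc p)) → p ≤ N →
    exec (eliminate {d} o) (working (flat (suc p) s) [] [] [] (ones (suc p))) ≡
    assert ((if o then some (s zero ∘ suc) ∨ (p ≡ᵇ 0) else true) ∧ agree (s zero ∘ suc) (λ i → s (suc i) zero))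
      (working (flat p (eliminated o s)) [] [] [] (ones p))
  eliminate-correct {d} o {p} s le = trans
    (cong (_>>= _) (duplicate-correct x _ le))
    (trans (cong (_>>= _) (required o)) (afterwards (if o then some x ∨ (p ≡ᵇ 0) else true)))
    where
    x h : Fin p → Bool
    x = s zero ∘ suc
    h i = s (suc i) zero
    M = rows (λ i → h i ∷ tabulate (s (suc i) ∘ suc))
    x≤N : length (tabulate x) ≤ N
    x≤N = ≤-trans (≤-reflexive (length-tabulate x)) le

    required : ∀ o → exec (if o then requireNeighbour {suc d} else skip) (working M (tabulate x) (tabulate x) []
        (ones p)) ≡
               assert (if o then some x ∨ (p ≡ᵇ 0) else true) (working M (tabulate x) (tabulate x) [] (ones p))
    required false = refl
    required true  = requireNeighbour-correct x M (tabulate x) le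

    processed : foldM (row o (tabulate x)) (tabulate x) M ≡ assert (agree x h) (flat p (eliminated o s))
    processed = subst (λ m → foldM (row o (tabulate x)) (tabulate x) m ≡ assert (agree x h) (flat p
        (eliminated o s))) (++-identityʳ M)
      (foldM-row o x x h (λ i → s (suc i) ∘ suc) [])

    afterwards : ∀ ok → (assert ok (working M (tabulate x) (tabulate x) [] (ones p)) >>= _) ≡
                 assert (ok ∧ agree x h) (working (flat p (eliminated o s)) [] [] [] (ones p))
    afterwards false = refl
    afterwards true  = trans (cong (_>>= _) (trans (rows-correct o {d} M (tabulate x) (tabulate x) (ones p) x≤N x≤N)
        (cong (Maybe.map _) processed)))
      (finish (agree x h))
      where
      finish : ∀ ok → (Maybe.map (λ m → working m (tabulate x) (tabulate x) [] (ones p)) (assert ok (flat p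
          (eliminated o s))) >>=
                        exec (drain {c = suc d} Queues.r (λ _ → skip) ⨟ drain Queues.c (λ _ → skip))) ≡
               assert ok (working (flat p (eliminated o s)) [] [] [] (ones p))
      finish false = refl
      finish true  = clear-correct o {suc d} _ _ _ _ x≤N x≤N

  eliminate-loop : ∀ {d} o n (s : Matrix n) k → n ≤ k → n ≤ N →
    iterate k (exec (eliminate {d} o)) (working (flat n s) [] [] [] (ones n)) ≡
    assert (accepts o n s) (working [] [] [] [] [])
  eliminate-loop o zero    s k       n≤k n≤N = iterate-fixed refl k
  eliminate-loop {d} o (suc p) s (suc k) (s≤s n≤k) n≤N = trans
    (cong (_>>= iterate k (exec (eliminate {d} o))) (eliminate-correct {d} o s (≤-trans (n≤1+n p) n≤N)))
    (go (if o then some (s zero ∘ suc) ∨ (p ≡ᵇ 0) else true) (agree (s zero ∘ suc) (λ i → s (suc i) zero)))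
    where
    go : ∀ x y → (assert (x ∧ y) (working (flat p (eliminated o s)) [] [] [] (ones p)) >>= iterate k (exec
        (eliminate {d} o))) ≡
         assert (x ∧ (y ∧ accepts o p (eliminated o s))) (working [] [] [] [] [])
    go false y     = refl
    go true  false = refl
    go true  true  = eliminate-loop {d} o p (eliminated o s) k n≤k (≤-trans (n≤1+n p) n≤N)

unflatten : ∀ m n bs → length bs ≡ m * n → ∃ λ (s : Fin m → Fin n → Bool) → bs ≡ rows (λ i → tabulate (s i))
unflatten zero    n []  eq = (λ ()) , refl
unflatten (suc m) n bs eq with take n bs | drop n bs | take++drop≡id n bs | trans (length-take n bs) (trans (cong
    (n ⊓_) eq) (m≤n⇒m⊓n≡m (m≤m+n n (m * n)))) | trans (length-drop n bs) (trans (cong (_∸ n) eq) (m+n∸m≡n n (m * n)))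
... | xs | ys | refl | refl | |ys| with unflatten m n ys |ys|
... | s , refl = (λ { zero → List.lookup xs ; (suc i) → s i }) , cong (_++ rows (λ i → tabulate (s i))) (Eq.sym
    (tabulate-lookup xs))

accepted : ∀ n → Matrix n → Bool
accepted n s = accepts false n s ∧ accepts true n s

-- Correctness of the output

paddedRow : Bool → ℕ → List Bool → List Bool
paddedRow onLeft n xs = if onLeft then xs ++ zeros else zeros ++ xs
  where zeros = false ∷ false ∷ replicate n false

block : Bool → ∀ n → Matrix n → List Bool
block onLeft n s = paddedRow onLeft n (true ∷ true ∷ ones n) ++ (paddedRow onLeft n (true ∷ false ∷ ones n) ++
                 rows (λ i → paddedRow onLeft n (true ∷ true ∷ tabulate (s i))))

encodedSum : ∀ n → Matrix n → Matrix n → List Bool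
encodedSum n s t = ones ((2 + n) * 2) ++ false ∷ (block true n s ++ block false n t)

module Emission (N n : ℕ) (n≤N : n ≤ N) (a b : List Bool) where
  open Execution N

  |ones|≤N : length (ones n) ≤ N
  |ones|≤N = ≤-trans (≤-reflexive (length-replicate n)) n≤N

  emitting : List Bool → List Bool → List Bool × List Bool → State 14
  emitting u u′ (m , io) = state io u u′ (ones n) [] a b m [] [] [] [] [] []

  emits-correct : ∀ {d} xs {u u′ m} io → exec (emits {d} xs) (emitting u u′ (m , io)) ≡ just (emitting u u′
      (m , io ++ xs))
  emits-correct []       io = cong (λ io → just (emitting _ _ (_ , io))) (Eq.sym (++-identityʳ io))
  emits-correct (x ∷ xs) io = trans (emits-correct xs (io ++ x ∷ [])) (cong (λ io → just (emitting _ _ (_ , io)))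
      (++-assoc io _ xs))

  iterate-snoc : ∀ {k} (xs : List Bool) (ys : ℕ → List Bool) → (ys 0 ≡ []) → (∀ k → ys (suc k) ≡ xs ++ ys k) → ∀ io →
                 iterate k (λ io → just (io ++ xs)) io ≡ just (io ++ ys k)
  iterate-snoc {zero}  xs ys ys-0 ys-suc io rewrite ys-0 = cong just (Eq.sym (++-identityʳ io))
  iterate-snoc {suc k} xs ys ys-0 ys-suc io rewrite ys-suc k =
    trans (iterate-snoc xs ys ys-0 ys-suc (io ++ xs)) (cong just (++-assoc io xs (ys k)))

  fill-correct : ∀ {d} x {u u′ m} io → exec (fill {d} x) (emitting u u′ (m , io)) ≡ just (emitting u u′
      (m , io ++ replicate n x))
  fill-correct {d} x {u} {u′} {m} io = trans
    (each-correct N {c = d} {g = λ v v′ io → state io u u′ v v′ a b m [] [] [] [] [] []} (λ _ _ _ _ _ → refl)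
      {f = λ _ io → just (io ++ x ∷ [])} (λ _ _ _ _ → refl) (ones n) io |ones|≤N)
    (cong (Maybe.map _) (trans (foldM-const (ones n) io) (trans (cong (λ k → iterate k (λ io → just
        (io ++ x ∷ [])) io) (length-replicate n))
      (iterate-snoc (x ∷ []) (λ k → replicate k x) refl (λ _ → refl) io))))

  zeros : List Bool
  zeros = false ∷ false ∷ replicate n false

  rowEffect : Bool → List Bool → (List Bool × List Bool → Maybe (List Bool × List Bool)) →
              List Bool × List Bool → Maybe (List Bool × List Bool)
  rowEffect false xs k (m , io) = k (m , (io ++ zeros) ++ xs)
  rowEffect true  xs k (m , io) = k (m , io ++ xs) >>= λ (m , io) → just (m , io ++ zeros)

  emitRow-correct : ∀ {d} onLeft xs {p : Cmd 14 (suc d)} {k u u′} →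
    (∀ mi → exec p (emitting u u′ mi) ≡ Maybe.map (emitting u u′) (k mi)) →
    ∀ mi → exec (emitRow onLeft xs p) (emitting u u′ mi) ≡ Maybe.map (emitting u u′) (rowEffect onLeft xs k mi)
  emitRow-correct {d} onLeft xs {p} {k} {u} {u′} hyp (m , io) = go onLeft
    where
    zeros-correct : ∀ m io → exec (emits {suc d} (false ∷ false ∷ []) ⨟ fill false) (emitting u u′ (m , io)) ≡
                    just (emitting u u′ (m , io ++ zeros))
    zeros-correct m io = trans (cong (_>>= exec (fill {d} false)) (emits-correct {suc d}
        (false ∷ false ∷ []) {u} {u′} {m} io))
      (trans (fill-correct {d} false (io ++ false ∷ false ∷ [])) (cong (λ io → just (emitting u u′ (m , io)))
          (++-assoc io _ _)))

    entries-correct : ∀ m io → exec (emits xs ⨟ p) (emitting u u′ (m , io)) ≡ Maybe.map (emitting u u′) (k (m , io ++ xs))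
    entries-correct m io = trans (cong (_>>= exec p) (emits-correct {suc d} xs {u} {u′} {m} io)) (hyp (m , io ++ xs))

    go : ∀ onLeft → exec (emitRow onLeft xs p) (emitting u u′ (m , io)) ≡ Maybe.map (emitting u u′)
        (rowEffect onLeft xs k (m , io))
    go false = trans (cong (_>>= exec (emits xs ⨟ p)) (zeros-correct m io)) (entries-correct m (io ++ zeros))
    go true  = seq (k (m , io ++ xs)) (entries-correct m io) (λ (m , io) _ → zeros-correct m io)

  rowEffect-just : ∀ onLeft xs {k m io m′ l} → (∀ io → k (m , io) ≡ just (m′ , io ++ l)) →
                   rowEffect onLeft xs k (m , io) ≡ just (m′ , io ++ paddedRow onLeft n (xs ++ l))
  rowEffect-just false xs {io = io} {m′} {l} eq = trans (eq ((io ++ zeros) ++ xs)) (cong (λ io → just (m′ , io))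
    (trans (++-assoc (io ++ zeros) xs l) (++-assoc io zeros (xs ++ l))))
  rowEffect-just true  xs {io = io} {m′} {l} eq rewrite eq (io ++ xs) = cong (λ io → just (m′ , io))
    (trans (++-assoc (io ++ xs) l zeros) (trans (++-assoc io xs (l ++ zeros)) (cong (io ++_) (Eq.sym
        (++-assoc xs l zeros)))))

  fillRow-correct : ∀ {d} onLeft xs {u u′ m} io → exec (emitRow {d} onLeft xs (fill true)) (emitting u u′ (m , io)) ≡
                    just (emitting u u′ (m , io ++ paddedRow onLeft n (xs ++ ones n)))
  fillRow-correct {d} onLeft xs {u} {u′} {m} io = trans
    (emitRow-correct {d} onLeft xs {k = λ (m , io) → just (m , io ++ ones n)} (λ
        (m , io) → fill-correct {d} true io) (m , io))
    (cong (Maybe.map (emitting u u′)) (rowEffect-just onLeft xs (λ _ → refl)))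

  iterate-pull : ∀ {k} (x : Fin k → Bool) m io → iterate k pull (tabulate x ++ m , io) ≡ just (m , io ++ tabulate x)
  iterate-pull {zero}  x m io = cong (λ io → just (m , io)) (Eq.sym (++-identityʳ io))
  iterate-pull {suc k} x m io = trans (iterate-pull (x ∘ suc) m (io ++ x zero ∷ []))
    (cong (λ io → just (m , io)) (++-assoc io _ _))

  matrixRow : Bool → List Bool × List Bool → Maybe (List Bool × List Bool)
  matrixRow onLeft = rowEffect onLeft (true ∷ true ∷ []) (iterate n pull)

  matrixRow-correct : ∀ {d} onLeft u u′ mi →
    exec (emitRow {d} onLeft (true ∷ true ∷ []) (each Queues.v Queues.v′ (λ _ → deq Queues.m abort
        (enq Queues.io)))) (emitting u u′ mi) ≡
    Maybe.map (emitting u u′) (matrixRow onLeft mi)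
  matrixRow-correct {d} onLeft u u′ = emitRow-correct onLeft (true ∷ true ∷ []) λ mi → trans
    (each-correct N {c = d} {g = λ v v′ (m , io) → state io u u′ v v′ a b m [] [] [] [] [] []} (λ _ _ _ _ _ → refl)
      {f = λ _ → pull} (λ { _ _ _ ([] , _) → refl ; _ _ _ (_ ∷ _ , _) → refl }) (ones n) mi |ones|≤N)
    (cong (Maybe.map (emitting u u′)) (trans (foldM-const (ones n) mi) (cong (λ k → iterate k pull mi)
        (length-replicate n))))

  iterate-row : ∀ {k} onLeft (s : Fin k → Fin n → Bool) io → iterate k (matrixRow onLeft) (rows (λ i → tabulate
      (s i)) , io) ≡
                just ([] , io ++ rows (λ i → paddedRow onLeft n (true ∷ true ∷ tabulate (s i))))
  iterate-row {zero}  onLeft s io = cong (λ io → just ([] , io)) (Eq.sym (++-identityʳ io))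
  iterate-row {suc k} onLeft s io = trans
    (cong (_>>= iterate k (matrixRow onLeft)) (rowEffect-just onLeft (true ∷ true ∷ []) {k = iterate n pull}
      (iterate-pull (s zero) (rows (λ i → tabulate (s (suc i)))))))
    (trans (iterate-row onLeft (s ∘ suc) (io ++ l)) (cong (λ io → just ([] , io)) (++-assoc io l _)))
    where l = paddedRow onLeft n (true ∷ true ∷ tabulate (s zero))

  emitBlock-correct : ∀ {d} onLeft s io → exec (emitBlock {d} onLeft) (emitting (ones n) [] (flat n s , io)) ≡
                      just (emitting (ones n) [] ([] , io ++ block onLeft n s))
  emitBlock-correct {d} onLeft s io = trans
    (cong (_>>= _) (fillRow-correct {suc d} onLeft (true ∷ true ∷ []) {ones n} {[]} {flat n s} io)) (trans
    (cong (_>>= _) (fillRow-correct {suc d} onLeft (true ∷ false ∷ []) {ones n} {[]} {flat n s} (io ++ l₁))) (trans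
    (each-correct N {c = suc d} {g = emitting} (λ _ _ _ _ _ → refl) {f = λ _ → matrixRow onLeft}
      (λ u u′ _ mi → matrixRow-correct {d} onLeft u u′ mi) (ones n) (flat n s , (io ++ l₁) ++ l₂) |ones|≤N) (trans
    (cong (Maybe.map (emitting (ones n) [])) (trans (foldM-const (ones n) _)
      (trans (cong (λ k → iterate k (matrixRow onLeft) (flat n s , (io ++ l₁) ++ l₂)) (length-replicate n))
          (iterate-row onLeft s ((io ++ l₁) ++ l₂)))))
    (cong (λ io → just (emitting (ones n) [] ([] , io))) (trans (++-assoc (io ++ l₁) l₂ _) (++-assoc io l₁ _))))))
    where
    l₁ = paddedRow onLeft n (true ∷ true ∷ ones n)
    l₂ = paddedRow onLeft n (true ∷ false ∷ ones n)

  copy-correct : ∀ {d} io {m} → length a ≤ N → length b ≤ N →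
    exec (copy {d} Queues.a Queues.r′ Queues.m) (emitting (ones n) [] ([] , io)) ≡ just (emitting (ones n) [] (a , io)) ×
    exec (copy {d} Queues.b Queues.r′ Queues.m) (emitting (ones n) [] ([] , io)) ≡ just (emitting (ones n) [] (b , io)) ×
    exec (copy {d} Queues.u Queues.u′ Queues.w) (emitting (ones n) [] (m , io)) ≡
      just (state io (ones n) [] (ones n) [] a b m [] [] [] [] [] (ones n))
  copy-correct {d} io {m} a≤N b≤N =
    trans (each-correct N {c = d} {g = λ a r′ m → state io (ones n) [] (ones n) [] a b m [] r′ [] [] [] []}
        (λ _ _ _ _ _ → refl)
      {f = λ x m → just (m ++ x ∷ [])} (λ _ _ _ _ → refl) a [] a≤N) (cong (Maybe.map _) (foldM-snoc a [])) ,
    trans (each-correct N {c = d} {g = λ b r′ m → state io (ones n) [] (ones n) [] a b m [] r′ [] [] [] []}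
        (λ _ _ _ _ _ → refl)
      {f = λ x m → just (m ++ x ∷ [])} (λ _ _ _ _ → refl) b [] b≤N) (cong (Maybe.map _) (foldM-snoc b [])) ,
    trans (each-correct N {c = d} {g = λ u u′ w → state io u u′ (ones n) [] a b m [] [] [] [] [] w} (λ _ _ _ _ _ → refl)
      {f = λ x w → just (w ++ x ∷ [])} (λ _ _ _ _ → refl) (ones n) [] |ones|≤N) (cong (Maybe.map _) (foldM-snoc
          (ones n) []))

module Phases (N n : ℕ) (n≤N : n ≤ N) (s t : Matrix n) (s≤N : length (flat n s) ≤ N) (t≤N : length (flat n t) ≤ N) where
  open Execution N
  open Emission N n n≤N (flat n s) (flat n t)
  open Elimination N [] (ones n) (ones n) (flat n s) (flat n t) using (eliminate-loop)

  private
    go : State 14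
    go = ready n (flat n s) (flat n t)

    copied : ∀ {d} io {m} → _
    copied {d} io {m} = copy-correct {d} io {m} s≤N t≤N

  eliminateAll-a : ∀ {d} o → exec (eliminateAll {d} Queues.a o) go ≡ assert (accepts o n s) go
  eliminateAll-a {d} o =
    >>=-congˡ (proj₁ (copied {suc (suc d)} [] {[]}))
    (>>=-congˡ (proj₂ (proj₂ (copied {suc (suc d)} [] {flat n s}))) (eliminate-loop {d} o n s N n≤N n≤N))

  eliminateAll-b : ∀ {d} o → exec (eliminateAll {d} Queues.b o) go ≡ assert (accepts o n t) go
  eliminateAll-b {d} o =
    >>=-congˡ (proj₁ (proj₂ (copied {suc (suc d)} [] {[]})))
    (>>=-congˡ (proj₂ (proj₂ (copied {suc (suc d)} [] {flat n t}))) (eliminate-loop {d} o n t N n≤N n≤N))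

  assert-∧ : ∀ {S : Set} {m} {k : S → Maybe S} {σ : S} x y → m ≡ assert x σ → k σ ≡ assert y σ →
      (m >>= k) ≡ assert (x ∧ y) σ
  assert-∧ false y refl eq = refl
  assert-∧ true  y refl eq = eq

  check-a : ∀ {d} → exec (check {d} Queues.a) go ≡ assert (accepted n s) go
  check-a {d} = assert-∧ (accepts false n s) (accepts true n s) (eliminateAll-a {d} false) (eliminateAll-a {d} true)

  check-b : ∀ {d} → exec (check {d} Queues.b) go ≡ assert (accepted n t) go
  check-b {d} = assert-∧ (accepts false n t) (accepts true n t) (eliminateAll-b {d} false) (eliminateAll-b {d} true)

  emit-correct : ∀ {d} → exec (emit {d}) go ≡ just (emitting (ones n) [] ([] , encodedSum n s t))
  emit-correct {d} =
    >>=-congˡ (trans (each-correct N {c = suc d} {g = λ u u′ io → emitting u u′ ([] , io)} (λ _ _ _ _ _ → refl)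
        {f = λ _ io → just (io ++ true ∷ true ∷ [])} (λ _ _ _ io → emits-correct {suc d} (true ∷ true ∷ []) io)
            (ones n) (ones 4) |ones|≤N)
      (cong (Maybe.map _) (trans (foldM-const (ones n) (ones 4))
        (trans (cong (λ k → iterate k (λ io → just (io ++ true ∷ true ∷ [])) (ones 4)) (length-replicate n))
          (iterate-snoc {n} (true ∷ true ∷ []) (λ k → ones (k * 2)) refl (λ _ → refl) (ones 4))))))
    (>>=-congˡ (proj₁ (copied {suc d} l₀ {[]}))
    (>>=-congˡ (emitBlock-correct {d} true s l₀)
    (>>=-congˡ (proj₁ (proj₂ (copied {suc d} (l₀ ++ block true n s) {[]})))
    (trans (emitBlock-correct {d} false t (l₀ ++ block true n s))
    (cong (λ io → just (emitting (ones n) [] ([] , io)))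
      (trans (++-assoc l₀ (block true n s) (block false n t)) (++-assoc (ones ((2 + n) * 2)) (false ∷ []) _)))))))
    where l₀ = ones ((2 + n) * 2) ++ false ∷ []

-- Fourteen queues, and three counters because the deepest nesting is elimination, rows, columns.
reduce : List Bool → List Bool
reduce = Program.eval 13 3 reduction

length-flat : ∀ n (s : Matrix n) → length (flat n s) ≡ n * n
length-flat n s = go s
  where
  go : ∀ {m} (s : Fin m → Fin n → Bool) → length (rows (λ i → tabulate (s i))) ≡ m * n
  go {zero}  s = refl
  go {suc m} s = trans (length-++ (tabulate (s zero))) (cong₂ _+_ (length-tabulate (s zero)) (go (s ∘ suc)))

private
  module Lengths (m : ℕ) (a b : List Bool) where
    x : List Bool
    x = encoded (suc m) a b

    n≤ : suc m ≤ length x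
    n≤ = ≤-trans (≤-reflexive (Eq.sym (length-replicate (suc m)))) (≤-trans (m≤m+n _ _) (≤-reflexive (Eq.sym
        (length-++ (ones (suc m))))))

    a≤ : length a ≤ length x
    a≤ = ≤-trans (≤-trans (m≤m+n _ _) (≤-trans (≤-reflexive (Eq.sym (length-++ a))) (≤-trans (n≤1+n _) (m≤n+m _
        (length (ones (suc m)))))))
      (≤-reflexive (Eq.sym (length-++ (ones (suc m)))))

    b≤ : length b ≤ length x
    b≤ = ≤-trans (≤-trans (≤-trans (n≤1+n _) (≤-trans (m≤n+m _ (length (ones (suc m)))) (≤-reflexive (Eq.sym
        (length-++ (ones (suc m)))))))
        (≤-trans (m≤n+m _ (length a)) (≤-trans (≤-reflexive (Eq.sym (length-++ a))) (≤-trans (n≤1+n _) (m≤n+m _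
            (length (ones (suc m))))))))
      (≤-reflexive (Eq.sym (length-++ (ones (suc m)))))

reduce-encoded : ∀ m (s t : Matrix (suc m)) → reduce (encoded (suc m) (flat (suc m) s) (flat (suc m) t)) ≡
                 (if accepted (suc m) s ∧ accepted (suc m) t then encodedSum (suc m) s t else [])
reduce-encoded m s t = trans
  (cong (maybe′ (λ σ → lookup σ zero) [])
    (>>=-congˡ (trans (parse-correct {1} x ≤-refl)
      (cong (Maybe.map _) (parsed-complete (length x) m (flat (suc m) s) (flat (suc m) t) (length-flat (suc m) s)
          (length-flat (suc m) t))))
    (checked (accepted (suc m) s) (accepted (suc m) t) check-a check-b)))
  (result (accepted (suc m) s) (accepted (suc m) t))
  where
  open Lengths m (flat (suc m) s) (flat (suc m) t)
  open Execution (length x)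
  open Phases (length x) (suc m) n≤ s t a≤ b≤
  open Emission (length x) (suc m) n≤ (flat (suc m) s) (flat (suc m) t) using (emitting)

  σ τ : State 14
  σ = ready (suc m) (flat (suc m) s) (flat (suc m) t)
  τ = emitting (ones (suc m)) [] ([] , encodedSum (suc m) s t)

  checked : ∀ p q → exec (check {0} Queues.a) σ ≡ assert p σ → exec (check {0} Queues.b) σ ≡ assert q σ →
            exec (check {0} Queues.a ⨟ check Queues.b ⨟ emit) σ ≡ (if p then (if q then just τ else nothing) else nothing)
  checked false q     pa pb = >>=-congˡ pa refl
  checked true  false pa pb = >>=-congˡ pa (>>=-congˡ pb refl)
  checked true  true  pa pb = >>=-congˡ pa (>>=-congˡ pb (emit-correct {1}))

  result : ∀ p q → maybe′ (λ σ → lookup σ zero) [] (if p then (if q then just τ else nothing) else nothing) ≡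
           (if p ∧ q then encodedSum (suc m) s t else [])
  result false q     = refl
  result true  false = refl
  result true  true  = refl

-- Serves the converse direction, where nothing is known about `x` beforehand.
reduce-cases : ∀ x → reduce x ≡ [] ⊎ ∃ λ m → ∃ λ (s : Matrix (suc m)) → ∃ λ (t : Matrix (suc m)) →
               x ≡ encoded (suc m) (flat (suc m) s) (flat (suc m) t)
reduce-cases x with Execution.parsed (length x) x in eq
... | nothing = inj₁ (cong (maybe′ (λ σ → lookup σ zero) [])
      (>>=-congˡ (trans (parse-correct {1} x ≤-refl) (cong (Maybe.map _) eq)) refl))
  where open Execution (length x)
... | just (zero  , a , b) with () ← proj₁ (parsed-sound (length x) x eq)
... | just (suc m , a , b) with parsed-sound (length x) x eq
... | _ , |a| , |b| , refl with unflatten (suc m) (suc m) a |a| | unflatten (suc m) (suc m) b |b|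
... | s , refl | t , refl = inj₂ (m , s , t , refl)

-- Products and disjoint unions of graphs

≃G-adj-from : ∀ {G H} ((φ , _) : G ≃G H) i j → adj G (Inverse.from φ i) (Inverse.from φ j) ≡ adj H i j
≃G-adj-from {H = H} (φ , p) i j = trans (Eq.sym (p _ _)) (cong₂ (adj H) (Inverse.strictlyInverseˡ φ i)
    (Inverse.strictlyInverseˡ φ j))

≃G-sym : ∀ {G H} → G ≃G H → H ≃G G
≃G-sym {G} {H} iso@(φ , _) = mk↔ₛ′ (Inverse.from φ) (Inverse.to φ) (Inverse.strictlyInverseʳ φ)
    (Inverse.strictlyInverseˡ φ) , ≃G-adj-from {G} {H} iso

≃G-trans : ∀ {G H K} → G ≃G H → H ≃G K → G ≃G K
≃G-trans (φ , p) (ψ , q) =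
  mk↔ₛ′ (Inverse.to ψ ∘ Inverse.to φ) (Inverse.from φ ∘ Inverse.from ψ)
    (λ z → trans (cong (Inverse.to ψ) (Inverse.strictlyInverseˡ φ _)) (Inverse.strictlyInverseˡ ψ z))
    (λ x → trans (cong (Inverse.from φ) (Inverse.strictlyInverseʳ ψ _)) (Inverse.strictlyInverseʳ φ x)) ,
  λ i j → trans (q _ _) (p i j)

cone : Bool → Graph → Graph
cone b G = record { n = suc (n G) ; adj = adj⁺ ; sym = sym⁺ }
  where
  adj⁺ : Fin (suc (n G)) → Fin (suc (n G)) → Bool
  adj⁺ zero    zero    = b
  adj⁺ zero    (suc j) = true
  adj⁺ (suc i) zero    = true
  adj⁺ (suc i) (suc j) = adj G i j
  sym⁺ : ∀ i j → adj⁺ i j ≡ adj⁺ j i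
  sym⁺ zero    zero    = refl
  sym⁺ zero    (suc j) = refl
  sym⁺ (suc i) zero    = refl
  sym⁺ (suc i) (suc j) = sym G i j

cone-cong : ∀ {b G H} → G ≃G H → cone b G ≃G cone b H
cone-cong (φ , p) = mk↔ₛ′ (lift (Inverse.to φ)) (lift (Inverse.from φ))
    (λ { zero → refl ; (suc y) → cong suc (Inverse.strictlyInverseˡ φ y) }) (λ { zero → refl ; (suc x) → cong suc
        (Inverse.strictlyInverseʳ φ x) }) ,
  λ { zero zero → refl ; zero (suc j) → refl ; (suc i) zero → refl ; (suc i) (suc j) → p i j }
  where
  lift : ∀ {m k} → (Fin m → Fin k) → Fin (suc m) → Fin (suc k)
  lift f zero    = zero
  lift f (suc x) = suc (f x)

-- The isomorphism may send the apex of the first cone to a node other than the apex of the second one.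
-- Such a node has the same adjacencies as the apex, so it can take over the role of the apex's image.
module Unapex {m k} (to : Fin (suc m) → Fin (suc k)) (from : Fin (suc k) → Fin (suc m)) (from-to : ∀ x → from
    (to x) ≡ x) where

  spec : ∀ x → ∃ λ y → to (suc x) ≡ suc y ⊎ (to (suc x) ≡ zero × to zero ≡ suc y)
  spec x with to (suc x) in eq | to zero in eq₀
  ... | suc y | _      = y , inj₁ refl
  ... | zero  | suc y  = y , inj₂ (refl , refl)
  ... | zero  | zero   with () ← trans (Eq.sym (from-to (suc x))) (trans (cong from (trans eq (Eq.sym eq₀)))
      (from-to zero))

  image : Fin m → Fin k
  image x = proj₁ (spec x)

  at-suc : ∀ {x w} → to (suc x) ≡ w → from w ≡ suc x
  at-suc p = trans (cong from (Eq.sym p)) (from-to _)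

  at-zero : ∀ {w} → to zero ≡ w → from w ≡ zero
  at-zero p = trans (cong from (Eq.sym p)) (from-to _)

  inverse : ∀ {x y z} → to (suc x) ≡ suc y ⊎ (to (suc x) ≡ zero × to zero ≡ suc y) →
            from (suc y) ≡ suc z ⊎ (from (suc y) ≡ zero × from zero ≡ suc z) → z ≡ x
  inverse (inj₁ p)       (inj₁ r)       = suc-injective (trans (Eq.sym r) (at-suc p))
  inverse (inj₁ p)       (inj₂ (r , _)) with () ← trans (Eq.sym r) (at-suc p)
  inverse (inj₂ (_ , q)) (inj₁ r)       with () ← trans (Eq.sym r) (at-zero q)
  inverse (inj₂ (p , _)) (inj₂ (_ , t)) = suc-injective (trans (Eq.sym t) (at-suc p))

cone-cancel : ∀ {b G H} → cone b G ≃G cone b H → G ≃G H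
cone-cancel {b} {G} {H} (φ , adj-φ) = mk↔ₛ′ There.image Back.image
    (λ y → Back.inverse (proj₂ (Back.spec y)) (proj₂ (There.spec (Back.image y))))
    (λ x → There.inverse (proj₂ (There.spec x)) (proj₂ (Back.spec (There.image x)))) ,
  adj-map
  where
  open Inverse φ using (to; from)
  module There = Unapex to from (Inverse.strictlyInverseʳ φ)
  module Back  = Unapex from to (Inverse.strictlyInverseˡ φ)

  adj-to : ∀ {i j k l} → to i ≡ k → to j ≡ l → adj (cone b H) k l ≡ adj (cone b G) i j
  adj-to p q = trans (Eq.sym (cong₂ (adj (cone b H)) p q)) (adj-φ _ _)

  adj-map : ∀ i j → adj H (There.image i) (There.image j) ≡ adj G i j
  adj-map i j with There.spec i | There.spec j
  ... | _ , inj₁ p       | _ , inj₁ q       = adj-to p q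
  -- Here and below both equations reduce to a common value: `true` when one apex is involved, and
  -- the loop flag `b`, which the two cones share, when both are.
  ... | _ , inj₁ p       | _ , inj₂ (q , r) = trans (adj-to p r) (adj-to p q)
  ... | _ , inj₂ (p , r) | _ , inj₁ q       = trans (adj-to r q) (adj-to p q)
  ... | _ , inj₂ (p , r) | _ , inj₂ (q , t) = trans (adj-to r t) (adj-to p q)

sumAdj : (G H : Graph) → Fin (n G) ⊎ Fin (n H) → Fin (n G) ⊎ Fin (n H) → Bool
sumAdj G H (inj₁ i) (inj₁ j) = adj G i j
sumAdj G H (inj₂ i) (inj₂ j) = adj H i j
sumAdj G H _        _        = false

infixr 6 _⊕_

_⊕_ : Graph → Graph → Graph
G ⊕ H = record
  { n   = n G + n H
  ; adj = λ i j → sumAdj G H (splitAt (n G) i) (splitAt (n G) j)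
  ; sym = λ i j → sumAdj-sym (splitAt (n G) i) (splitAt (n G) j) }
  where
  sumAdj-sym : ∀ v w → sumAdj G H v w ≡ sumAdj G H w v
  sumAdj-sym (inj₁ i) (inj₁ j) = sym G i j
  sumAdj-sym (inj₁ i) (inj₂ j) = refl
  sumAdj-sym (inj₂ i) (inj₁ j) = refl
  sumAdj-sym (inj₂ i) (inj₂ j) = sym H i j

⊕-unconnected : ∀ {G H} → Fin (n G) → Fin (n H) → ¬ Connected (G ⊕ H)
⊕-unconnected {G} {H} i j (_ , walks) = stays (walks (i ↑ˡ n H) (n G ↑ʳ j)) (splitAt-↑ˡ (n G) i (n H)) (splitAt-↑ʳ
    (n G) (n H) j)
  where
  stays : ∀ {v w i j} → Walk (G ⊕ H) v w → splitAt (n G) v ≡ inj₁ i → splitAt (n G) w ≡ inj₂ j → ⊥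
  stays here p q with () ← trans (Eq.sym p) q
  stays {v} (step {j = k} e w) p q with splitAt (n G) v | splitAt (n G) k in eq
  stays (step e w) refl q | inj₁ _ | inj₁ _ = stays w eq q

loop⇒¬bipartite : ∀ {G} i → adj G i i ≡ true → ¬ Bipartite G
loop⇒¬bipartite i e (c , proper) = proper i i e refl

twoLoops : Graph
twoLoops = record { n = 2 ; adj = λ i j → does (i ≟ j) ; sym = λ
  { zero zero → refl ; zero (suc zero) → refl ; (suc zero) zero → refl ; (suc zero) (suc zero) → refl } }

⊕-composite : ∀ {G H} → Nontrivial G → G ≃G H → Composite (G ⊕ H)
⊕-composite {G} {H} 1<n iso@(φ , p) = twoLoops , G , s≤s (s≤s z≤n) , 1<n ,
  mk↔ₛ′ to′ from′ to′-from′ from′-to′ , adj-to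
  where
  code : Fin (n G) ⊎ Fin (n H) → Fin 2 × Fin (n G)
  code (inj₁ x) = zero , x
  code (inj₂ y) = suc zero , Inverse.from φ y

  decode : Fin 2 × Fin (n G) → Fin (n G) ⊎ Fin (n H)
  decode (zero     , x) = inj₁ x
  decode (suc zero , x) = inj₂ (Inverse.to φ x)

  code-decode : ∀ c → code (decode c) ≡ c
  code-decode (zero     , x) = refl
  code-decode (suc zero , x) = cong (suc zero ,_) (Inverse.strictlyInverseʳ φ x)

  decode-code : ∀ v → decode (code v) ≡ v
  decode-code (inj₁ x) = refl
  decode-code (inj₂ y) = cong inj₂ (Inverse.strictlyInverseˡ φ y)

  to′ : Fin (n G + n H) → Fin (2 * n G)
  to′ i = let (c , x) = code (splitAt (n G) i) in combine c x

  from′ : Fin (2 * n G) → Fin (n G + n H)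
  from′ k = join (n G) (n H) (decode (remQuot {2} (n G) k))

  split-to′ : ∀ i → remQuot {2} (n G) (to′ i) ≡ code (splitAt (n G) i)
  split-to′ i = remQuot-combine {2} _ _

  to′-from′ : ∀ k → to′ (from′ k) ≡ k
  to′-from′ k = trans (cong (λ v → let (c , x) = code v in combine c x) (splitAt-join (n G) (n H) (decode (remQuot {2} (n G) k))))
    (trans (cong (λ (c , x) → combine c x) (code-decode (remQuot {2} (n G) k))) (combine-remQuot {2} (n G) k))

  from′-to′ : ∀ i → from′ (to′ i) ≡ i
  from′-to′ i = trans (cong (join (n G) (n H) ∘ decode) (split-to′ i))
    (trans (cong (join (n G) (n H)) (decode-code (splitAt (n G) i))) (join-splitAt (n G) (n H) i))

  adj-code : ∀ v w → (adj twoLoops (proj₁ (code v)) (proj₁ (code w)) ∧ adj G (proj₂ (code v)) (proj₂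
      (code w))) ≡ sumAdj G H v w
  adj-code (inj₁ x) (inj₁ y) = refl
  adj-code (inj₁ x) (inj₂ y) = refl
  adj-code (inj₂ x) (inj₁ y) = refl
  adj-code (inj₂ x) (inj₂ y) = ≃G-adj-from {G} {H} iso x y

  adj-to : ∀ i j → adj (twoLoops ⊗ G) (to′ i) (to′ j) ≡ adj (G ⊕ H) i j
  adj-to i j = trans
    (cong₂ (λ (c , x) (d , y) → adj twoLoops c d ∧ adj G x y) (split-to′ i) (split-to′ j))
    (adj-code (splitAt (n G) i) (splitAt (n G) j))

-- Factorizations of a disjoint union

record Factorization (G H A B : Graph) : Set where
  field
    to      : Fin (n G) ⊎ Fin (n H) → Fin (n A) × Fin (n B)
    from    : Fin (n A) × Fin (n B) → Fin (n G) ⊎ Fin (n H)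
    to-from : ∀ p → to (from p) ≡ p
    from-to : ∀ v → from (to v) ≡ v
    adj-to  : ∀ v w → (adj A (proj₁ (to v)) (proj₁ (to w)) ∧ adj B (proj₂ (to v)) (proj₂ (to w))) ≡ sumAdj G H v w

-- Together with `swap-factors` this replaces the appeals to symmetry: only the first summand under
-- the assumption `b₁ ∼ b₂` has to be analysed.
swap-sides : ∀ {G H A B} → Factorization G H A B → Factorization H G A B
swap-sides {G} {H} F = record
  { to      = to ∘ swap
  ; from    = swap ∘ from
  ; to-from = λ p → trans (cong to (swap-involutive (from p))) (to-from p)
  ; from-to = λ v → trans (cong swap (from-to (swap v))) (swap-involutive v)
  ; adj-to  = λ v w → trans (adj-to (swap v) (swap w)) (sumAdj-swap v w) }
  where
  open Factorization F
  sumAdj-swap : ∀ v w → sumAdj G H (swap v) (swap w) ≡ sumAdj H G v w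
  sumAdj-swap (inj₁ _) (inj₁ _) = refl
  sumAdj-swap (inj₁ _) (inj₂ _) = refl
  sumAdj-swap (inj₂ _) (inj₁ _) = refl
  sumAdj-swap (inj₂ _) (inj₂ _) = refl

swap-factors : ∀ {G H A B} → Factorization G H A B → Factorization G H B A
swap-factors {A = A} {B} F = record
  { to      = Prod.swap ∘ to
  ; from    = from ∘ Prod.swap
  ; to-from = λ p → cong Prod.swap (to-from (Prod.swap p))
  ; from-to = from-to
  ; adj-to  = λ v w → trans (∧-comm (adj B _ _) (adj A _ _)) (adj-to v w) }
  where open Factorization F

-- All that the cancellation argument uses of `doubleCone`. In particular `p` carries a loop.
record Hub (G : Graph) : Set where
  field
    p u       : Fin (n G)
    p-adj     : ∀ x → adj G p x ≡ true
    u-adj     : ∀ x → x ≢ u → adj G u x ≡ true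
    u-loopless : adj G u u ≡ false

other : ∀ {G} → Nontrivial G → ∀ x → ∃ λ (y : Fin (n G)) → y ≢ x
other {G} 1<n x with n G
other (s≤s (s≤s _)) zero    | suc (suc _) = suc zero , λ ()
other (s≤s (s≤s _)) (suc x) | suc (suc _) = zero , λ ()

module Sides {G H A B} (hub₁ : Hub G) (hub₂ : Hub H) (F : Factorization G H A B) where
  open Factorization F public
  open Hub hub₁ public renaming (p to p₁; u to u₁; p-adj to p₁-adj; u-adj to u₁-adj; u-loopless to u₁-loopless)
  open Hub hub₂ public renaming (p to p₂; u to u₂; p-adj to p₂-adj; u-adj to u₂-adj; u-loopless to u₂-loopless)

  infix 4 _∼ᴬ_ _∼ᴮ_
  _∼ᴬ_ : Fin (n A) → Fin (n A) → Set
  x ∼ᴬ y = adj A x y ≡ true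
  _∼ᴮ_ : Fin (n B) → Fin (n B) → Set
  x ∼ᴮ y = adj B x y ≡ true

  a₁ a₂ α : Fin (n A)
  b₁ b₂ β : Fin (n B)
  a₁ = proj₁ (to (inj₁ p₁))
  b₁ = proj₂ (to (inj₁ p₁))
  a₂ = proj₁ (to (inj₂ p₂))
  b₂ = proj₂ (to (inj₂ p₂))
  α  = proj₁ (to (inj₁ u₁))
  β  = proj₂ (to (inj₁ u₁))

  adjacent : ∀ {v x y w} → from (x , y) ≡ w → sumAdj G H v w ≡ true → proj₁ (to v) ∼ᴬ x × proj₂ (to v) ∼ᴮ y
  adjacent {v} {x} {y} refl e = ∧-conicalˡ _ _ both , ∧-conicalʳ _ _ both
    where
    both : (adj A (proj₁ (to v)) x ∧ adj B (proj₂ (to v)) y) ≡ true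
    both = trans (cong (λ (x , y) → adj A (proj₁ (to v)) x ∧ adj B (proj₂ (to v)) y) (Eq.sym (to-from (x , y))))
        (trans (adj-to v (from (x , y))) e)

  near₁ : ∀ {x y k} → from (x , y) ≡ inj₁ k → a₁ ∼ᴬ x × b₁ ∼ᴮ y
  near₁ {k = k} eq = adjacent eq (p₁-adj k)

  near₂ : ∀ {x y k} → from (x , y) ≡ inj₂ k → a₂ ∼ᴬ x × b₂ ∼ᴮ y
  near₂ {k = k} eq = adjacent eq (p₂-adj k)

  near-to : ∀ k → a₁ ∼ᴬ proj₁ (to (inj₁ k)) × b₁ ∼ᴮ proj₂ (to (inj₁ k))
  near-to k = near₁ (from-to (inj₁ k))

  disjoint : ∀ {x y} → a₁ ∼ᴬ x → b₁ ∼ᴮ y → a₂ ∼ᴬ x → b₂ ∼ᴮ y → ⊥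
  disjoint {x} {y} p q r s = clash (from (x , y)) (edge (inj₁ p₁) p q) (edge (inj₂ p₂) r s)
    where
    edge : ∀ v → proj₁ (to v) ∼ᴬ x → proj₂ (to v) ∼ᴮ y → sumAdj G H v (from (x , y)) ≡ true
    edge v p q = trans (Eq.sym (adj-to v (from (x , y)))) (trans
      (cong (λ (x , y) → adj A (proj₁ (to v)) x ∧ adj B (proj₂ (to v)) y) (to-from (x , y))) (cong₂ _∧_ p q))
    clash : ∀ w → sumAdj G H (inj₁ p₁) w ≡ true → sumAdj G H (inj₂ p₂) w ≡ true → ⊥
    clash (inj₁ _) _ ()
    clash (inj₂ _) () _

  -- Under the assumption b₁ ∼ b₂ the first summand becomes {α} × B.
  module Column (nontrivial : Nontrivial B) (b₁∼b₂ : b₁ ∼ᴮ b₂) where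

    -- Otherwise `(x , b₁)` would be adjacent to `p₁` and to `p₂`: the loop at `p₁` gives `b₁ ∼ b₁`,
    -- and `b₂ ∼ b₁` is the assumption.
    separate : ∀ {x} → a₁ ∼ᴬ x → a₂ ∼ᴬ x → ⊥
    separate p q = disjoint {y = b₁} p (proj₂ (near-to p₁)) q (trans (sym B b₂ b₁) b₁∼b₂)

    inside : ∀ {x} y → a₁ ∼ᴬ x → ∃ λ k → from (x , y) ≡ inj₁ k
    inside {x} y p with from (x , y) in eq
    ... | inj₁ k = k , refl
    ... | inj₂ k = ⊥-elim (separate p (proj₁ (near₂ eq)))

    u₁∼ : ∀ {x y} → a₁ ∼ᴬ x → (x , y) ≢ (α , β) → α ∼ᴬ x × β ∼ᴮ y
    u₁∼ {x} {y} p ≢u with inside y p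
    ... | k , eq = adjacent eq (u₁-adj k λ { refl → ≢u (trans (Eq.sym (to-from (x , y))) (cong to eq)) })

    a₁∼α : a₁ ∼ᴬ α
    a₁∼α = proj₁ (near-to u₁)

    -- Nontriviality of `B` provides another node in the same column as `u₁`. It belongs to the
    -- first summand, hence `u₁` is adjacent to it, and the first coordinates give the loop.
    α∼α : α ∼ᴬ α
    α∼α = let (y , y≢β) = other {B} nontrivial β in proj₁ (u₁∼ {y = y} a₁∼α (y≢β ∘ cong proj₂))

    -- If `x` were different, `u₁` would be adjacent to `(x , β)`, whence `β ∼ β`. With the loop at
    -- `α` this would put a loop at `u₁`.
    only-α : ∀ {x} → a₁ ∼ᴬ x → x ≡ α
    only-α {x} p with x ≟ α
    ... | yes eq = eq
    ... | no x≢α with () ← trans (Eq.sym u₁-loopless) (trans (Eq.sym (adj-to (inj₁ u₁) (inj₁ u₁)))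
          (cong₂ _∧_ α∼α (proj₂ (u₁∼ {y = β} p λ { refl → x≢α refl }))))

    column : ∀ k → proj₁ (to (inj₁ k)) ≡ α
    column k = only-α (proj₁ (near-to k))

    at : ∀ y → Fin (n G)
    at y = proj₁ (inside y a₁∼α)

    from-at : ∀ y → from (α , y) ≡ inj₁ (at y)
    from-at y = proj₂ (inside y a₁∼α)

    to-at : ∀ y → to (inj₁ (at y)) ≡ (α , y)
    to-at y = trans (cong to (Eq.sym (from-at y))) (to-from (α , y))

    height : Fin (n G) → Fin (n B)
    height k = proj₂ (to (inj₁ k))

    at-height : ∀ k → at (height k) ≡ k
    at-height k = inj₁-injective (trans (Eq.sym (from-at (height k)))
      (trans (cong (λ x → from (x , height k)) (Eq.sym (column k))) (from-to (inj₁ k))))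

    height-at : ∀ y → height (at y) ≡ y
    height-at y = cong proj₂ (to-at y)

    -- In a single column with a loop at `α`, the first coordinate imposes no condition on
    -- adjacency.
    adj-height : ∀ k l → adj B (height k) (height l) ≡ adj G k l
    adj-height k l = trans (cong (_∧ adj B (height k) (height l)) (Eq.sym (trans (cong₂ (adj A) (column k)
        (column l)) α∼α)))
      (adj-to (inj₁ k) (inj₁ l))

    G≃B : G ≃G B
    G≃B = mk↔ₛ′ height at height-at at-height , adj-height

factors-≃ : ∀ {G H A B} → Hub G → Hub H → Factorization G H A B → Nontrivial A → Nontrivial B → G ≃G H
factors-≃ {G} {H} {A} {B} hub₁ hub₂ F 1<A 1<B with from (a₁ , b₂) in eq
  where open Sides hub₁ hub₂ F
... | inj₁ _ = ≃G-trans {G} {B} {H} (Column.G≃B 1<B b₁∼b₂)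
      (≃G-sym {H} {B} (Sides.Column.G≃B hub₂ hub₁ (swap-sides F) 1<B (trans (sym B b₂ b₁) b₁∼b₂)))
  where
  open Sides hub₁ hub₂ F
  b₁∼b₂ = proj₂ (near₁ eq)
... | inj₂ _ = ≃G-trans {G} {A} {H} (Sides.Column.G≃B hub₁ hub₂ (swap-factors F) 1<A (trans (sym A a₁ a₂) a₂∼a₁))
      (≃G-sym {H} {A} (Sides.Column.G≃B hub₂ hub₁ (swap-sides (swap-factors F)) 1<A a₂∼a₁))
  where
  open Sides hub₁ hub₂ F
  a₂∼a₁ = proj₁ (near₂ eq)

composite-⊕ : ∀ {G H} → Hub G → Hub H → Composite (G ⊕ H) → G ≃G H
composite-⊕ {G} {H} hub₁ hub₂ (A , B , 1<A , 1<B , φ , adj-φ) = factors-≃ hub₁ hub₂ F 1<A 1<B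
  where
  F : Factorization G H A B
  F = record
    { to      = λ v → remQuot {n A} (n B) (Inverse.to φ (join (n G) (n H) v))
    ; from    = λ (x , y) → splitAt (n G) (Inverse.from φ (combine x y))
    ; to-from = λ (x , y) → trans (cong (remQuot {n A} (n B) ∘ Inverse.to φ) (join-splitAt (n G) (n H) _))
        (trans (cong (remQuot {n A} (n B)) (Inverse.strictlyInverseˡ φ (combine x y))) (remQuot-combine x y))
    ; from-to = λ v → trans (cong (splitAt (n G) ∘ Inverse.from φ) (combine-remQuot {n A} (n B) _))
        (trans (cong (splitAt (n G)) (Inverse.strictlyInverseʳ φ _)) (splitAt-join (n G) (n H) v))
    ; adj-to  = λ v w → trans (adj-φ (join (n G) (n H) v) (join (n G) (n H) w))
        (cong₂ (sumAdj G H) (splitAt-join (n G) (n H) v) (splitAt-join (n G) (n H) w)) }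

doubleCone : Graph → Graph
doubleCone G = cone true (cone false G)

doubleCone-hub : ∀ G → Hub (doubleCone G)
doubleCone-hub G = record
  { p = zero ; u = suc zero
  ; p-adj = λ { zero → refl ; (suc _) → refl }
  ; u-adj = λ { zero _ → refl ; (suc zero) ≢u → ⊥-elim (≢u refl) ; (suc (suc _)) _ → refl }
  ; u-loopless = refl }

composite⇔≃ : ∀ G H → (G ≃G H → Composite (doubleCone G ⊕ doubleCone H)) × (Composite
    (doubleCone G ⊕ doubleCone H) → G ≃G H)
composite⇔≃ G H =
  (λ iso → ⊕-composite (s≤s (s≤s z≤n)) (cone-cong {true} {cone false G} {cone false H} (cone-cong {false} {G} {H} iso))) ,
  (λ c → cone-cancel {false} {G} {H} (cone-cancel {true} {cone false G} {cone false H}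
    (composite-⊕ (doubleCone-hub G) (doubleCone-hub H) c)))

Composite-resp-≃G : ∀ {G H} → G ≃G H → Composite G → Composite H
Composite-resp-≃G {G} {H} iso (A , B , 1<A , 1<B , iso′) =
  A , B , 1<A , 1<B , ≃G-trans {H} {G} {A ⊗ B} (≃G-sym {G} {H} iso) iso′

-- Connectivity and encodings

Symmetric : ∀ {n} → Matrix n → Set
Symmetric s = ∀ i j → s i j ≡ s j i

eliminated-symmetric : ∀ o {p} {s : Matrix (suc p)} → Symmetric s → Symmetric (eliminated o s)
eliminated-symmetric o {s = s} s-sym i j = cong₂ (λ x y → x ∨ (o ∧ y)) (s-sym (suc i) (suc j))
  (trans (∧-comm (s (suc i) zero) (s zero (suc j))) (cong₂ _∧_ (s-sym zero (suc j)) (s-sym (suc i) zero)))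

agree-sound : ∀ {p} (x y : Fin p → Bool) → agree x y ≡ true → ∀ i → x i ≡ y i
agree-sound x y eq zero = same (x zero) (y zero) (∧-conicalˡ _ _ eq)
  where
  same : ∀ a b → not (a xor b) ≡ true → a ≡ b
  same false false _ = refl
  same true  true  _ = refl
agree-sound x y eq (suc i) = agree-sound (x ∘ suc) (y ∘ suc) (∧-conicalʳ _ _ eq) i

agree-complete : ∀ {p} (x y : Fin p → Bool) → (∀ i → x i ≡ y i) → agree x y ≡ true
agree-complete {zero}  x y eq = refl
agree-complete {suc p} x y eq = cong₂ _∧_ (trans (cong (λ a → not (a xor y zero)) (eq zero)) (cong not (xor-same
    (y zero))))
  (agree-complete (x ∘ suc) (y ∘ suc) (eq ∘ suc))

some-sound : ∀ {p} (x : Fin p → Bool) → some x ≡ true → ∃ λ i → x i ≡ true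
some-sound {suc p} x eq with x zero in eq₀
... | true  = zero , eq₀
... | false = let (i , eq′) = some-sound (x ∘ suc) eq in suc i , eq′

some-complete : ∀ {p} (x : Fin p → Bool) i → x i ≡ true → some x ≡ true
some-complete x zero    eq = cong (_∨ some (x ∘ suc)) eq
some-complete x (suc i) eq = trans (cong (x zero ∨_) (some-complete (x ∘ suc) i eq)) (∨-zeroʳ (x zero))

accepts-false-sound : ∀ n (s : Matrix n) → accepts false n s ≡ true → Symmetric s
accepts-false-sound (suc p) s eq = go
  where
  border : ∀ i → s zero (suc i) ≡ s (suc i) zero
  border = agree-sound (s zero ∘ suc) (λ i → s (suc i) zero) (∧-conicalˡ _ _ eq)
  go : Symmetric s
  go zero    zero    = refl
  go zero    (suc j) = border j
  go (suc i) zero    = Eq.sym (border i)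
  go (suc i) (suc j) = trans (Eq.sym (∨-identityʳ _))
    (trans (accepts-false-sound p (eliminated false s) (∧-conicalʳ _ _ eq) i j) (∨-identityʳ _))

accepts-false-complete : ∀ n (s : Matrix n) → Symmetric s → accepts false n s ≡ true
accepts-false-complete zero    s s-sym = refl
accepts-false-complete (suc p) s s-sym = cong₂ _∧_ (agree-complete (s zero ∘ suc) (λ i → s (suc i) zero)
    (λ i → s-sym zero (suc i)))
  (accepts-false-complete p (eliminated false s) (eliminated-symmetric false s-sym))

graph : ∀ {n} (s : Matrix n) → Symmetric s → Graph
graph {n} s s-sym = record { n = n ; adj = s ; sym = s-sym }

module _ {p : ℕ} {s : Matrix (suc p)} (s-sym : Symmetric s) where
  private
    G G′ : Graph
    G  = graph s s-sym
    G′ = graph (eliminated true s) (eliminated-symmetric true s-sym)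

  -- A stay at the deleted node, however often its loop is used, is bypassed by the clique edge
  -- between the nodes before and after it. The clique includes loops, which covers a return to the
  -- same node.
  eliminated-walk : ∀ {i j} → Walk G (suc i) (suc j) → Walk G′ i j
  eliminated-walk-via : ∀ {i j} → s (suc i) zero ≡ true → Walk G zero (suc j) → Walk G′ i j
  eliminated-walk here                      = here
  eliminated-walk (step {j = zero}  e w)    = eliminated-walk-via e w
  eliminated-walk {i} (step {j = suc k} e w) = step (cong (_∨ (s (suc i) zero ∧ s zero (suc k))) e) (eliminated-walk w)
  eliminated-walk-via e (step {j = zero}  _  w) = eliminated-walk-via e w
  eliminated-walk-via e (step {j = suc k} e′ w) = step (trans (cong (s _ _ ∨_) (cong₂ _∧_ e e′)) (∨-zeroʳ _))
      (eliminated-walk w)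

  -- A clique edge that was not there before is replaced by the two edges through the deleted node.
  original-walk : ∀ {i j} → Walk G′ i j → Walk G (suc i) (suc j)
  original-walk here = here
  original-walk (step {i} {k} e w) with s (suc i) (suc k) in eq
  ... | true  = step eq (original-walk w)
  ... | false = step (∧-conicalˡ _ _ e) (step (∧-conicalʳ _ _ e) (original-walk w))

  neighbour : ∀ {j} → Walk G zero (suc j) → ∃ λ k → s zero (suc k) ≡ true
  neighbour (step {j = zero}  _ w) = neighbour w
  neighbour (step {j = suc k} e _) = k , e

accepts-true-sound : ∀ n (s : Matrix n) (s-sym : Symmetric s) → accepts true n s ≡ true → ∀ i j → Walk (graph s s-sym) i j
accepts-true-sound (suc p) s s-sym eq = go
  where
  walks : ∀ i j → Walk (graph s s-sym) (suc i) (suc j)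
  walks i j = original-walk s-sym (accepts-true-sound p (eliminated true s) (eliminated-symmetric true s-sym)
    (∧-conicalʳ (agree (s zero ∘ suc) (λ i → s (suc i) zero)) _ (∧-conicalʳ (some (s zero ∘ suc) ∨ (p ≡ᵇ 0)) _ eq)) i j)

  adjacent-to : Fin p → ∃ λ k → s zero (suc k) ≡ true
  -- The existence of `i` makes `p` positive, so the exemption for the last node does not apply.
  adjacent-to i = some-sound (s zero ∘ suc) (positive p i (∧-conicalˡ (some (s zero ∘ suc) ∨ (p ≡ᵇ 0)) _ eq))
    where
    positive : ∀ p {b} → Fin p → (b ∨ (p ≡ᵇ 0)) ≡ true → b ≡ true
    positive (suc p) _ eq = trans (Eq.sym (∨-identityʳ _)) eq

  go : ∀ i j → Walk (graph s s-sym) i j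
  go zero    zero    = here
  go zero    (suc j) = let (k , e) = adjacent-to j in step e (walks k j)
  go (suc i) zero    = let (k , e) = adjacent-to i in walk-snoc (walks i k) (trans (s-sym (suc k) zero) e)
    where
    walk-snoc : ∀ {i j k} → Walk (graph s s-sym) i j → s j k ≡ true → Walk (graph s s-sym) i k
    walk-snoc here       e = step e here
    walk-snoc (step f w) e = step f (walk-snoc w e)
  go (suc i) (suc j) = walks i j

accepts-true-complete : ∀ n (s : Matrix n) (s-sym : Symmetric s) → (∀ i j → Walk
    (graph s s-sym) i j) → accepts true n s ≡ true
accepts-true-complete zero    s s-sym walks = refl
accepts-true-complete (suc p) s s-sym walks = cong₂ _∧_ (adjacent p s s-sym walks)
  (cong₂ _∧_ (agree-complete (s zero ∘ suc) (λ i → s (suc i) zero) (λ i → s-sym zero (suc i)))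
    (accepts-true-complete p (eliminated true s) (eliminated-symmetric true s-sym) (λ i j → eliminated-walk s-sym
        (walks (suc i) (suc j)))))
  where
  adjacent : ∀ p (s : Matrix (suc p)) (s-sym : Symmetric s) → (∀ i j → Walk (graph s s-sym) i j) → (some
      (s zero ∘ suc) ∨ (p ≡ᵇ 0)) ≡ true
  adjacent zero    s s-sym walks = refl
  adjacent (suc p) s s-sym walks = let (k , e) = neighbour s-sym (walks zero (suc zero)) in
    cong (_∨ false) (some-complete (s zero ∘ suc) k e)

accepted-sound : ∀ m (s : Matrix (suc m)) → accepted (suc m) s ≡ true → ∃ λ s-sym → Connected (graph s s-sym)
accepted-sound m s eq = s-sym , s≤s z≤n , accepts-true-sound (suc m) s s-sym (∧-conicalʳ (accepts false (suc m) s) _ eq)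
  where s-sym = accepts-false-sound (suc m) s (∧-conicalˡ _ (accepts true (suc m) s) eq)

accepted-complete : ∀ m (s : Matrix (suc m)) s-sym → Connected (graph s s-sym) → accepted (suc m) s ≡ true
accepted-complete m s s-sym (_ , walks) = cong₂ _∧_ (accepts-false-complete (suc m) s s-sym)
    (accepts-true-complete (suc m) s s-sym walks)

encGraph-flat : ∀ G → encGraph G ≡ ones (n G) ++ false ∷ flat (n G) (adj G)
encGraph-flat G = cong (λ l → ones (n G) ++ false ∷ concat l) (trans
  (map-tabulate id (λ i → map (adj G i) (allFin (n G))))
  (tabulate-cong (λ i → map-tabulate id (adj G i))))

rows-cong : ∀ {m} {f g : Fin m → List Bool} → (∀ i → f i ≡ g i) → rows f ≡ rows g
rows-cong eq = cong concat (tabulate-cong eq)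

rows-++ : ∀ a b (f : Fin (a + b) → List Bool) → rows f ≡ rows (λ i → f (i ↑ˡ b)) ++ rows (λ j → f (a ↑ʳ j))
rows-++ zero    b f = refl
rows-++ (suc a) b f = trans (cong (f zero ++_) (rows-++ a b (f ∘ suc))) (Eq.sym (++-assoc (f zero) _ _))

tabulate-++ : ∀ a b (f : Fin (a + b) → Bool) → tabulate f ≡ tabulate (λ i → f (i ↑ˡ b)) ++ tabulate (λ j → f (a ↑ʳ j))
tabulate-++ zero    b f = refl
tabulate-++ (suc a) b f = cong (f zero ∷_) (tabulate-++ a b (f ∘ suc))

tabulate-const : ∀ n (x : Bool) → tabulate {n = n} (λ _ → x) ≡ replicate n x
tabulate-const zero    x = refl
tabulate-const (suc n) x = cong (x ∷_) (tabulate-const n x)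

flat-⊕ : ∀ G H → flat (n G + n H) (adj (G ⊕ H)) ≡
         rows (λ i → tabulate (adj G i) ++ replicate (n H) false) ++ rows (λ j → replicate (n G) false ++ tabulate
             (adj H j))
flat-⊕ G H = trans (rows-++ (n G) (n H) _) (cong₂ _++_
  (rows-cong λ i → trans (tabulate-++ (n G) (n H) _) (cong₂ _++_
    (tabulate-cong λ j → cong₂ (sumAdj G H) (splitAt-↑ˡ (n G) i (n H)) (splitAt-↑ˡ (n G) j (n H)))
    (trans (tabulate-cong λ j → cong₂ (sumAdj G H) (splitAt-↑ˡ (n G) i (n H)) (splitAt-↑ʳ (n G) (n H) j))
        (tabulate-const (n H) false))))
  (rows-cong λ i → trans (tabulate-++ (n G) (n H) _) (cong₂ _++_
    (trans (tabulate-cong λ j → cong₂ (sumAdj G H) (splitAt-↑ʳ (n G) (n H) i) (splitAt-↑ˡ (n G) j (n H)))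
        (tabulate-const (n G) false))
    (tabulate-cong λ j → cong₂ (sumAdj G H) (splitAt-↑ʳ (n G) (n H) i) (splitAt-↑ʳ (n G) (n H) j)))))

-- `f` stands for the padding of a row with zeros, on the right in the first summand and on the left
-- in the second.
rows-doubleCone : ∀ {n} (s : Matrix n) s-sym (f : List Bool → List Bool) →
  rows (λ i → f (tabulate (adj (doubleCone (graph s s-sym)) i))) ≡
  f (true ∷ true ∷ ones n) ++ (f (true ∷ false ∷ ones n) ++ rows (λ i → f (true ∷ true ∷ tabulate (s i))))
rows-doubleCone {n} s s-sym f rewrite tabulate-const n true = refl

encGraph-sum : ∀ {n} (s t : Matrix n) s-sym t-sym →
               encGraph (doubleCone (graph s s-sym) ⊕ doubleCone (graph t t-sym)) ≡ encodedSum n s t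
encGraph-sum {n} s t s-sym t-sym = trans (encGraph-flat (G ⊕ H))
  (cong₂ (λ k l → ones k ++ false ∷ l) (double (2 + n)) (trans (flat-⊕ G H) (cong₂ _++_
    (rows-doubleCone s s-sym (_++ replicate (2 + n) false)) (rows-doubleCone t t-sym (replicate (2 + n) false ++_)))))
  where
  G = doubleCone (graph s s-sym)
  H = doubleCone (graph t t-sym)
  double : ∀ k → k + k ≡ k * 2
  double k = trans (cong (k +_) (Eq.sym (+-identityʳ k))) (*-comm 2 k)

-- The first `false` delimits the unary size.
ones-injective : ∀ m k {x y} → ones m ++ false ∷ x ≡ ones k ++ false ∷ y → m ≡ k × x ≡ y
ones-injective zero    zero    refl = refl , refl
ones-injective (suc m) (suc k) eq   = Prod.map₁ (cong suc) (ones-injective m k (proj₂ (∷-injective eq)))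

++-injective : ∀ (as bs : List Bool) {cs ds} → length as ≡ length bs → as ++ cs ≡ bs ++ ds → as ≡ bs × cs ≡ ds
++-injective []       []       _   eq = refl , eq
++-injective (a ∷ as) (b ∷ bs) len eq with ∷-injective eq
... | refl , eq′ = Prod.map₁ (cong (a ∷_)) (++-injective as bs (cong pred len) eq′)

tabulate-injective : ∀ {k} {f g : Fin k → Bool} → tabulate f ≡ tabulate g → ∀ i → f i ≡ g i
tabulate-injective eq zero    = proj₁ (∷-injective eq)
tabulate-injective eq (suc i) = tabulate-injective (proj₂ (∷-injective eq)) i

flat-injective : ∀ {m k} {f g : Fin m → Fin k → Bool} → rows (λ i → tabulate (f i)) ≡ rows (λ i → tabulate
    (g i)) → ∀ i j → f i j ≡ g i j
flat-injective {suc m} {f = f} {g} eq i j with ++-injective (tabulate (f zero)) (tabulate (g zero))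
  (trans (length-tabulate (f zero)) (Eq.sym (length-tabulate (g zero)))) eq
flat-injective eq zero    j | p , _ = tabulate-injective p j
flat-injective eq (suc i) j | _ , q = flat-injective q i j

-- Equal encodings give pointwise equal matrices, and the identity is then an isomorphism; the
-- graphs as records also contain proofs of symmetry.
encGraph-injective : ∀ G H → encGraph G ≡ encGraph H → G ≃G H
encGraph-injective G H eq = go G H (trans (Eq.sym (encGraph-flat G)) (trans eq (encGraph-flat H)))
  where
  go : ∀ G H → ones (n G) ++ false ∷ flat (n G) (adj G) ≡ ones (n H) ++ false ∷ flat (n H) (adj H) → G ≃G H
  go record { n = k ; adj = s } record { n = l ; adj = t } eq with ones-injective k l eq
  ... | refl , eq′ = mk↔ₛ′ id id (λ _ → refl) (λ _ → refl) , λ i j → Eq.sym (flat-injective eq′ i j)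

-- Correctness of the reduction

encoded-graphs : ∀ {n} (s t : Matrix n) s-sym t-sym →
                 encGraph (graph s s-sym) ++ encGraph (graph t t-sym) ≡ encoded n (flat n s) (flat n t)
encoded-graphs {n} s t s-sym t-sym = trans (cong₂ _++_ (encGraph-flat (graph s s-sym)) (encGraph-flat (graph t t-sym)))
  (++-assoc (ones n) _ _)

forward : ∀ x → GI-Connected x → Composite-UnconnNonbip (reduce x)
forward x (record { n = zero } , _ , _ , (() , _) , _)
forward x (record { n = suc m ; adj = s ; sym = s-sym } , record { adj = t ; sym = t-sym } , refl , G-conn , H-conn , iso)
  -- Isomorphic graphs have the same order, as the parser demands.
  with ↔⇒≡ (proj₁ iso)
... | refl = doubleCone G ⊕ doubleCone H , reduced ,
    ⊕-unconnected {doubleCone G} {doubleCone H} zero zero , loop⇒¬bipartite {doubleCone G ⊕ doubleCone H} zero refl ,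
    proj₁ (composite⇔≃ G H) iso
  where
  G = graph s s-sym
  H = graph t t-sym
  reduced : reduce (encGraph G ++ encGraph H) ≡ encGraph (doubleCone G ⊕ doubleCone H)
  reduced = trans (cong reduce (encoded-graphs s t s-sym t-sym)) (trans (reduce-encoded m s t)
    (trans (cong₂ (λ b c → if b ∧ c then encodedSum (suc m) s t else []) (accepted-complete m s s-sym G-conn)
        (accepted-complete m t t-sym H-conn))
      (Eq.sym (encGraph-sum s t s-sym t-sym))))

encGraph-nonempty : ∀ G → encGraph G ≢ []
encGraph-nonempty record { n = zero }  ()
encGraph-nonempty record { n = suc _ } ()

backward : ∀ x → Composite-UnconnNonbip (reduce x) → GI-Connected x
backward x (K , reduced , _ , _ , composite) with reduce-cases x
... | inj₁ empty = ⊥-elim (encGraph-nonempty K (trans (Eq.sym reduced) empty))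
... | inj₂ (m , s , t , refl) = go (accepted (suc m) s) (accepted (suc m) t) refl refl (trans (Eq.sym
    (reduce-encoded m s t)) reduced)
  where
  go : ∀ p q → accepted (suc m) s ≡ p → accepted (suc m) t ≡ q → (if p ∧ q then encodedSum
      (suc m) s t else []) ≡ encGraph K →
       GI-Connected (encoded (suc m) (flat (suc m) s) (flat (suc m) t))
  go false q     _  _  eq = ⊥-elim (encGraph-nonempty K (Eq.sym eq))
  go true  false _  _  eq = ⊥-elim (encGraph-nonempty K (Eq.sym eq))
  go true  true  ps pt eq with accepted-sound m s ps | accepted-sound m t pt
  ... | s-sym , G-conn | t-sym , H-conn =
    graph s s-sym , graph t t-sym , Eq.sym (encoded-graphs s t s-sym t-sym) , G-conn , H-conn ,
    -- The given `K` merely has the same encoding as the constructed sum, so its compositeness is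
    -- carried over along an isomorphism.
    proj₂ (composite⇔≃ (graph s s-sym) (graph t t-sym)) (Composite-resp-≃G {K} {doubleCone
        (graph s s-sym) ⊕ doubleCone (graph t t-sym)}
      (encGraph-injective K (doubleCone (graph s s-sym) ⊕ doubleCone (graph t t-sym)) (trans (Eq.sym eq) (Eq.sym
          (encGraph-sum s t s-sym t-sym)))) composite)

theorem3 : GI-Connected ≤ₚ Composite-UnconnNonbip
theorem3 = reduce , eval-polytime reduction , λ x → forward x , backward x
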